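{- Let $k\ge 3$ and let $F$ be a $k$-graph. Suppose that there exist $r\in\mathbb N$ and a set $\mathscr P\subseteq [r]^{k}$ (the set of $k$-tuples with entries in $[r]=\{1,\dots,r\}$) with the following property: for every $n\in\mathbb N$ and every map $\psi:\binom{[n]}{k-1}\to[r]$ (defined on the $(k-1)$-element subsets of $[n]$), the $k$-graph $H$ with vertex set $[n]$ and edge set \[ E(H)=\Big\{e=\{i_1<i_2<\dots<i_k\}\subseteq[n]:\ \big(\psi(e\setminus\{i_1\}),\psi(e\setminus\{i_2\}),\dots,\psi(e\setminus\{i_k\})\big)\in\mathscr P\Big\} \] is $F$-free. Then $\pi_{k-2}(F)\ge |\mathscr P|/r^k$.
   Context: A $k$-graph is a pair $H=(V,E)$ with $E$ a set of $k$-element subsets of the finite set $V$; $H$ is $F$-free if it contains no subhypergraph isomorphic to $F$. For an integer $0\le j<k$ and a $j$-graph $G$ on vertex set $V$, let $\mathcal K_k(G)$ denote the set of $k$-subsets of $V$ all of whose $j$-subsets are edges of $G$ (for $j=0$ there are two $0$-graphs: with empty edge set, or with the empty set as an edge). Given $d\in[0,1]$ and $\mu>0$, a $k$-graph $H=(V,E)$ with $n$ vertices is $(d,\mu,j)$-dense if $|\mathcal K_k(G)\cap E|\ge d|\mathcal K_k(G)|-\mu n^k$ for every $j$-graph $G$ with vertex set $V$. For a $k$-graph $F$, $\pi_j(F)$ is the supremum of all $d\in[0,1]$ such that for every $\mu>0$ and every $n_0\in\mathbb N$ there exists an $F$-free $(d,\mu,j)$-dense $k$-graph $H$ with at least $n_0$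 vertices. -}

module Defs where

open import Data.Bool using (Bool; true; false; _∧_; not; if_then_else_)
open import Data.Nat using (ℕ; zero; suc; _^_; _≡ᵇ_) renaming (_≤_ to _≤ℕ_)
open import Data.Nat.Base using (_∸_)
open import Data.Fin using (Fin; zero; suc; _≟_)
open import Data.Fin.Properties using (any?)
open import Data.Fin.Subset using (Subset; inside; outside; ∣_∣; _∈_) renaming (_-_ to _without_)
open import Data.Fin.Subset.Properties using (_∈?_)
open import Data.List using (List; []; _∷_; map; _++_; filter; length; concatMap; allFin)
open import Data.Vec using (Vec; []; _∷_; tabulate)
open import Data.Integer using (+_)
open import Data.Rational using (ℚ; _/_; _*_; _-_; _≤_; _<_; 0ℚ)
open import Data.Product using (Σ; _×_; _,_; ∃)
open import Relation.Nullary.Decidable using (⌊_⌋; _×-dec_)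
open import Relation.Binary.PropositionalEquality using (_≡_)
open import Function.Definitions using (Injective)

ℕ→ℚ : ℕ → ℚ
ℕ→ℚ m = (+ m) / 1

allSubsets : ∀ n → List (Subset n)
allSubsets zero = [] ∷ []
allSubsets (suc n) = map (inside ∷_) (allSubsets n) ++ map (outside ∷_) (allSubsets n)

subsetᵇ : ∀ {n} → Subset n → Subset n → Bool
subsetᵇ [] [] = true
subsetᵇ (inside ∷ s) (outside ∷ t) = false
subsetᵇ (_ ∷ s) (_ ∷ t) = subsetᵇ s t

elements : ∀ {n} → Subset n → List (Fin n)
elements [] = []
elements (inside ∷ p) = zero ∷ map suc (elements p)
elements (outside ∷ p) = map suc (elements p)

allᵇ : ∀ {A : Set} → (A → Bool) → List A → Bool
allᵇ p [] = true
allᵇ p (x ∷ xs) = p x ∧ allᵇ p xs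

count : ∀ {A : Set} → (A → Bool) → List A → ℕ
count p xs = length (filter (λ x → p x Data.Bool.≟ true) xs)
  where import Data.Bool

-- A k-graph (resp. j-graph) on vertex set Fin n is given by an indicator
-- G : Subset n → Bool; its edges are the k-subsets e with G e ≡ true.
Graph : ℕ → Set
Graph n = Subset n → Bool

isEdgeᵇ : ∀ {n} → ℕ → Graph n → Subset n → Bool
isEdgeᵇ k G e = (∣ e ∣ ≡ᵇ k) ∧ G e

Kk : ∀ {n} → ℕ → ℕ → Graph n → List (Subset n)
Kk {n} j k G = filter (λ s → isKᵇ s Data.Bool.≟ true) (allSubsets n)
  where
  import Data.Bool
  isKᵇ : Subset n → Bool
  isKᵇ s = (∣ s ∣ ≡ᵇ k) ∧ allᵇ (λ t → not (subsetᵇ t s ∧ (∣ t ∣ ≡ᵇ j)) Data.Bool.∨ G t) (allSubsets n)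

Dense : ∀ {n} → ℕ → ℕ → ℚ → ℚ → Graph n → Set
Dense {n} k j d μ H = (G : Graph n) →
  ((d * ℕ→ℚ (length (Kk j k G))) - (μ * ℕ→ℚ (n ^ k))) ≤ ℕ→ℚ (count (isEdgeᵇ k H) (Kk j k G))

image : ∀ {m n} → (Fin m → Fin n) → Subset m → Subset n
image φ e = tabulate (λ v → if ⌊ any? (λ u → (u ∈? e) ×-dec (φ u ≟ v)) ⌋ then inside else outside)

Contains : ∀ {m n} → ℕ → Graph m → Graph n → Set
Contains {m} {n} k F H = Σ (Fin m → Fin n) λ φ → Injective _≡_ _≡_ φ ×
  ((e : Subset m) → isEdgeᵇ k F e ≡ true → isEdgeᵇ k H (image φ e) ≡ true)

Free : ∀ {m n} → ℕ → Graph m → Graph n → Set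
Free k F H = Contains k F H → Data.Empty.⊥
  where import Data.Empty

-- d belongs to the set whose supremum is π_j(F)
InPiSet : ∀ {m} → ℕ → ℕ → Graph m → ℚ → Set
InPiSet k j F d = (μ : ℚ) → 0ℚ < μ → (n₀ : ℕ) →
  Σ ℕ λ n → n₀ ≤ℕ n × Σ (Graph n) λ H → Free k F H × Dense k j d μ H

-- π_j(F) ≥ a / b  (with b possibly 0, in which case it is vacuous):
-- every rational d ≥ 0 with d < a / b lies in the set defining π_j(F)
-- (this set is downward closed in d, so this is equivalent to sup ≥ a/b)
PiAtLeast : ∀ {m} → ℕ → ℕ → Graph m → ℕ → ℕ → Set
PiAtLeast k j F a b = (d : ℚ) → 0ℚ ≤ d → d * ℕ→ℚ b < ℕ→ℚ a → InPiSet k j F d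

allTuples : ∀ r → ℕ → List (List (Fin r))
allTuples r zero = [] ∷ []
allTuples r (suc k) = concatMap (λ x → map (x ∷_) (allTuples r k)) (allFin r)

Hψ : ∀ {r n} → ℕ → (List (Fin r) → Bool) → (Subset n → Fin r) → Graph n
Hψ k P ψ e = (∣ e ∣ ≡ᵇ k) ∧ P (map (λ i → ψ (e without i)) (elements e))

{-# OPTIONS --safe #-}
module Submission where

-- Colour the (k-1)-sets uniformly at random and sort the k-sets into classes by the sum of their
-- vertices.  Two k-sets that share a (k-1)-subset and have the same vertex sum coincide, so within a
-- class the events "e is an edge" are independent, each of probability |P|/r^k.  For d = α/β below
-- this probability, Chernoff's argument with base z = 1 + 1/q bounds the probability that a class
-- of M cliques of a (k-2)-graph G contains fewer than dM - t edges by z^(-βt), independently of M.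
-- There are about kn classes and only 2^(n choose k-2) graphs G, so the union bound allows
-- t = O(n^(k-2)), and the total error O(n^(k-1)) is eventually below μ n^k.
-- Everything is done in ℕ: means over colourings are sums, and powers of z are cleared of
-- denominators.

open import Defs
open import Data.Bool using (Bool; true; false; if_then_else_; not; _∧_; _∨_)
import Data.Bool as Bool
open import Data.Bool.Properties using (T-≡; ∧-comm; ∧-zeroʳ)
open import Data.Nat using (ℕ; zero; suc; _+_; _*_; _^_; _∸_; _≤_; _<_; _≡ᵇ_; _<?_; z≤n; s≤s; NonZero; >-nonZero)
open import Data.Nat.Coprimality using (Coprime)
open import Data.Nat.ListAction using (sum; product)
open import Data.Nat.Properties hiding (_≟_)
open import Data.Nat.Tactic.RingSolver using (solve-∀)
open import Data.Fin using (Fin; zero; suc; toℕ)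
import Data.Fin.Properties as Fin
open import Data.Fin.Subset using (Subset; inside; outside; ∣_∣) renaming (_∈_ to _∈ˢ_; _-_ to _without_)
open import Data.Fin.Subset.Properties using (p─⊥≡p)
import Data.Integer as ℤ
import Data.Integer.Properties as ℤ
open import Data.List using (List; []; _∷_; map; _++_; length; filter; concatMap; allFin; upTo)
open import Data.List.Properties using (map-cong; map-cong-local; map-∘; map-upTo; length-map; length-++; length-tabulate; length-upTo)
import Data.List.Membership.DecPropositional as DecMembership
open import Data.List.Membership.Propositional using (_∈_; _∉_)
open import Data.List.Membership.Propositional.Properties using (∈-map⁺; ∈-map⁻; ∈-++⁺ˡ; ∈-++⁺ʳ; ∈-filter⁺; ∈-upTo⁺; ∈-upTo⁻)
open import Data.List.Relation.Unary.All as All using (All; []; _∷_)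
open import Data.List.Relation.Unary.AllPairs as AllPairs using (AllPairs; []; _∷_)
open import Data.List.Relation.Unary.Any using (here; there)
open import Data.List.Relation.Unary.Unique.Propositional using (Unique)
import Data.List.Relation.Unary.Unique.Propositional.Properties as Unique
open import Data.Product using (_×_; _,_; ∃; proj₁; proj₂; map₂)
open import Data.Rational as ℚ using (mkℚ; toℚᵘ)
import Data.Rational.Properties as ℚ
open import Data.Rational.Unnormalised as ℚᵘ using (mkℚᵘ; *≤*; *<*)
import Data.Rational.Unnormalised.Properties as ℚᵘ
open import Data.Sum as Sum using (_⊎_; inj₁; inj₂)
open import Data.Vec using ([]; _∷_; here; there)
open import Data.Vec.Properties using (∷-injectiveˡ; ∷-injectiveʳ; ≡-dec)
open import Function using (_∘_; id; Equivalence)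
open import Relation.Binary.Definitions using (DecidableEquality)
open import Relation.Binary.PropositionalEquality
open import Relation.Nullary using (yes; no; contradiction)

-- Two obstacles shape the argument: k-sets with a common (k-1)-subset are dependent, and one
-- colouring must serve every G. The n-k+1 k-sets containing a given (k-1)-set must lie in different
-- classes, so a linear number of classes is forced; vertex sums reach this order with an explicit
-- key. The error t of a class has to beat the logarithm n^(k-2) of the number of graphs, and a
-- linear number of classes then leaves a factor n to spare. For (k-1)-graphs G the same count would
-- give t of order n^(k-1) and a total of order n^k, with nothing to spare. Because d is strictly
-- below |P|/r^k, z can be chosen from d and P before n. An edge gets the factor 1 and a non-edge
-- z^β; the mean factor is at most z^γ with γ = β - α. A class with X edges and Y non-edges among M
-- = X + Y cliques has the product z^(βY), and βY - γM = αM - βX is β times the shortfall below dM.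
-- If the product is less than U z^(γM), this exponent is below log U to base z, hence at most q log
-- U to base 2, since z^q ≥ 2.

private variable
  A B : Set
  n : ℕ

-- Finite sums and products

∑ ∏ : List A → (A → ℕ) → ℕ
∑ xs f = sum (map f xs)
∏ xs f = product (map f xs)

∑-cong : ∀ (xs : List A) {f g : A → ℕ} → (∀ x → f x ≡ g x) → ∑ xs f ≡ ∑ xs g
∑-cong xs f≗g = cong sum (map-cong f≗g xs)

∏-cong : ∀ (xs : List A) {f g : A → ℕ} → (∀ x → f x ≡ g x) → ∏ xs f ≡ ∏ xs g
∏-cong xs f≗g = cong product (map-cong f≗g xs)

∑-mono-local : ∀ (xs : List A) {f g : A → ℕ} → (∀ {x} → x ∈ xs → f x ≤ g x) → ∑ xs f ≤ ∑ xs g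
∑-mono-local []       f≤g = z≤n
∑-mono-local (x ∷ xs) f≤g = +-mono-≤ (f≤g (here refl)) (∑-mono-local xs (f≤g ∘ there))

∑-mono-≤ : ∀ (xs : List A) {f g : A → ℕ} → (∀ x → f x ≤ g x) → ∑ xs f ≤ ∑ xs g
∑-mono-≤ xs f≤g = ∑-mono-local xs λ {x} _ → f≤g x

∑-const : ∀ (xs : List A) c → ∑ xs (λ _ → c) ≡ length xs * c
∑-const []       c = refl
∑-const (x ∷ xs) c = cong (c +_) (∑-const xs c)

∑-distrib-+ : ∀ (xs : List A) (f g : A → ℕ) → ∑ xs (λ x → f x + g x) ≡ ∑ xs f + ∑ xs g
∑-distrib-+ []       f g = refl
∑-distrib-+ (x ∷ xs) f g rewrite ∑-distrib-+ xs f g = +-interchange (f x) (g x) (∑ xs f) (∑ xs g)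
  where
  +-interchange : ∀ a b c d → a + b + (c + d) ≡ a + c + (b + d)
  +-interchange = solve-∀

*-distribˡ-∑ : ∀ (xs : List A) c (f : A → ℕ) → ∑ xs (λ x → c * f x) ≡ c * ∑ xs f
*-distribˡ-∑ []       c f = sym (*-zeroʳ c)
*-distribˡ-∑ (x ∷ xs) c f rewrite *-distribˡ-∑ xs c f = sym (*-distribˡ-+ c (f x) (∑ xs f))

∑-swap : ∀ (xs : List A) (ys : List B) (f : A → B → ℕ) →
  ∑ xs (λ x → ∑ ys (f x)) ≡ ∑ ys (λ y → ∑ xs (λ x → f x y))
∑-swap []       ys f = sym (trans (∑-const ys 0) (*-zeroʳ (length ys)))
∑-swap (x ∷ xs) ys f rewrite ∑-swap xs ys f = sym (∑-distrib-+ ys (f x) (λ y → ∑ xs (λ x → f x y)))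

∑-++ : ∀ (xs ys : List A) (f : A → ℕ) → ∑ (xs ++ ys) f ≡ ∑ xs f + ∑ ys f
∑-++ []       ys f = refl
∑-++ (x ∷ xs) ys f rewrite ∑-++ xs ys f = sym (+-assoc (f x) _ _)

∑-map : ∀ (xs : List A) (h : A → B) (f : B → ℕ) → ∑ (map h xs) f ≡ ∑ xs (f ∘ h)
∑-map []       h f = refl
∑-map (x ∷ xs) h f = cong (f (h x) +_) (∑-map xs h f)

∑-concatMap : ∀ (xs : List A) (h : A → List B) (f : B → ℕ) →
  ∑ (concatMap h xs) f ≡ ∑ xs (λ x → ∑ (h x) f)
∑-concatMap []       h f = refl
∑-concatMap (x ∷ xs) h f = trans (∑-++ (h x) _ f) (cong (∑ (h x) f +_) (∑-concatMap xs h f))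

≤∑ : ∀ {xs : List A} {x} (f : A → ℕ) → x ∈ xs → f x ≤ ∑ xs f
≤∑ f (here refl)       = m≤m+n _ _
≤∑ f (there {x = y} p) = ≤-trans (≤∑ f p) (m≤n+m _ (f y))

∑-<⇒∃ : ∀ (xs : List A) (f : A → ℕ) c → ∑ xs f < length xs * c → ∃ λ x → f x < c
∑-<⇒∃ (x ∷ xs) f c lt with f x <? c
... | yes fx<c = x , fx<c
... | no  fx≮c = ∑-<⇒∃ xs f c (+-cancelˡ-< c _ _ (≤-<-trans (+-monoˡ-≤ (∑ xs f) (≮⇒≥ fx≮c)) lt))

-- Summation over colourings ψ : I → Fin r, one coordinate at a time

module Colourings {I : Set} (_≟_ : DecidableEquality I) (r : ℕ) where

  Colouring : Set
  Colouring = I → Fin r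

  infixl 9 _[_≔_]

  _[_≔_] : Colouring → I → Fin r → Colouring
  (ψ [ i ≔ x ]) j with i ≟ j
  ... | yes _ = x
  ... | no  _ = ψ j

  update-same : ∀ ψ i x → (ψ [ i ≔ x ]) i ≡ x
  update-same ψ i x with i ≟ i
  ... | yes _  = refl
  ... | no i≢i = contradiction refl i≢i

  update-other : ∀ ψ {i j} x → i ≢ j → (ψ [ i ≔ x ]) j ≡ ψ j
  update-other ψ {i} {j} x i≢j with i ≟ j
  ... | yes i≡j = contradiction i≡j i≢j
  ... | no _    = refl

  update-overwrite : ∀ ψ i x y j → (ψ [ i ≔ x ] [ i ≔ y ]) j ≡ (ψ [ i ≔ y ]) j
  update-overwrite ψ i x y j with i ≟ j
  ... | yes _   = refl
  ... | no  i≢j = update-other ψ x i≢j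

  update-comm : ∀ ψ {i k} x y → i ≢ k → ∀ j → (ψ [ i ≔ x ] [ k ≔ y ]) j ≡ (ψ [ k ≔ y ] [ i ≔ x ]) j
  update-comm ψ {i} {k} x y i≢k j with i ≟ j | k ≟ j
  ... | yes refl | yes refl = contradiction refl i≢k
  ... | yes refl | no  k≢j  = update-same ψ j x
  ... | no  i≢j  | yes refl = sym (update-same ψ j y)
  ... | no  i≢j  | no  k≢j  = trans (update-other ψ x i≢j) (sym (update-other ψ y k≢j))

  update-cong : ∀ {ψ ψ′ : Colouring} → (∀ j → ψ j ≡ ψ′ j) → ∀ i x j → (ψ [ i ≔ x ]) j ≡ (ψ′ [ i ≔ x ]) j
  update-cong ψ≗ψ′ i x j with i ≟ j
  ... | yes _ = refl
  ... | no  _ = ψ≗ψ′ j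

  -- Different orders of updating give colourings that agree only pointwise. Without function
  -- extensionality, a sum can be reordered only for functionals that respect pointwise equality.
  Extensional : (Colouring → ℕ) → Set
  Extensional F = ∀ {ψ ψ′} → (∀ j → ψ j ≡ ψ′ j) → F ψ ≡ F ψ′

  Independent : I → (Colouring → ℕ) → Set
  Independent i F = ∀ ψ x → F (ψ [ i ≔ x ]) ≡ F ψ

  sumAt : I → (Colouring → ℕ) → Colouring → ℕ
  sumAt i F ψ = ∑ (allFin r) λ x → F (ψ [ i ≔ x ])

  -- An unnormalised expectation: `r ^ length L` times the mean of `F` when the coordinates in `L`
  -- are redrawn uniformly and the others are kept from `ψ`.
  sumOver : List I → (Colouring → ℕ) → Colouring → ℕ
  sumOver []      F = F
  sumOver (i ∷ L) F = sumAt i (sumOver L F)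

  length-allFin : length (allFin r) ≡ r
  length-allFin = length-tabulate {n = r} id

  ∑-Fin-const : ∀ c → ∑ (allFin r) (λ _ → c) ≡ r * c
  ∑-Fin-const c = trans (∑-const (allFin r) c) (cong (_* c) length-allFin)

  sumAt-cong : ∀ i {F G} → (∀ ψ → F ψ ≡ G ψ) → ∀ ψ → sumAt i F ψ ≡ sumAt i G ψ
  sumAt-cong i F≗G ψ = ∑-cong (allFin r) λ x → F≗G _

  sumOver-cong : ∀ L {F G} → (∀ ψ → F ψ ≡ G ψ) → ∀ ψ → sumOver L F ψ ≡ sumOver L G ψ
  sumOver-cong []      F≗G = F≗G
  sumOver-cong (i ∷ L) F≗G = sumAt-cong i (sumOver-cong L F≗G)

  sumAt-ext : ∀ i {F} → Extensional F → Extensional (sumAt i F)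
  sumAt-ext i extF ψ≗ψ′ = ∑-cong (allFin r) λ x → extF (update-cong ψ≗ψ′ i x)

  sumOver-ext : ∀ L {F} → Extensional F → Extensional (sumOver L F)
  sumOver-ext []      extF = extF
  sumOver-ext (i ∷ L) extF = sumAt-ext i (sumOver-ext L extF)

  sumAt-comm : ∀ i k {F} → Extensional F → ∀ ψ → sumAt i (sumAt k F) ψ ≡ sumAt k (sumAt i F) ψ
  sumAt-comm i k {F} extF ψ with i ≟ k
  ... | yes refl = refl
  ... | no  i≢k  = trans
    (∑-cong (allFin r) λ x → ∑-cong (allFin r) λ y → extF (update-comm ψ x y i≢k))
    (∑-swap (allFin r) (allFin r) λ x y → F (ψ [ k ≔ y ] [ i ≔ x ]))

  sumAt-scale : ∀ i c F ψ → sumAt i (λ ψ′ → c * F ψ′) ψ ≡ c * sumAt i F ψ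
  sumAt-scale i c F ψ = *-distribˡ-∑ (allFin r) c _

  sumOver-scale : ∀ L c F ψ → sumOver L (λ ψ′ → c * F ψ′) ψ ≡ c * sumOver L F ψ
  sumOver-scale []      c F ψ = refl
  sumOver-scale (i ∷ L) c F ψ = trans (sumAt-cong i (sumOver-scale L c F) ψ) (sumAt-scale i c (sumOver L F) ψ)

  sumAt-independent : ∀ {i F} → Independent i F → ∀ ψ → sumAt i F ψ ≡ r * F ψ
  sumAt-independent {F = F} ind ψ = trans (∑-cong (allFin r) (ind ψ)) (∑-Fin-const (F ψ))

  sumAt-makes-independent : ∀ i {F} → Extensional F → Independent i (sumAt i F)
  sumAt-makes-independent i extF ψ x = ∑-cong (allFin r) λ y → extF (update-overwrite ψ i x y)

  sumAt-preserves-independent : ∀ {i} k {F} → Extensional F → Independent i F → Independent i (sumAt k F)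
  sumAt-preserves-independent {i} k extF ind ψ x with i ≟ k
  ... | yes refl = sumAt-makes-independent i extF ψ x
  ... | no  i≢k  = ∑-cong (allFin r) λ y → trans (extF (update-comm ψ x y i≢k)) (ind (ψ [ k ≔ y ]) x)

  sumOver-preserves-independent : ∀ {i} L {F} → Extensional F → Independent i F → Independent i (sumOver L F)
  sumOver-preserves-independent []      extF ind = ind
  sumOver-preserves-independent (k ∷ L) extF ind =
    sumAt-preserves-independent k (sumOver-ext L extF) (sumOver-preserves-independent L extF ind)

  sumOver-sumAt-comm : ∀ L i {F} → Extensional F → ∀ ψ → sumOver L (sumAt i F) ψ ≡ sumAt i (sumOver L F) ψ
  sumOver-sumAt-comm []      i extF ψ = refl
  sumOver-sumAt-comm (k ∷ L) i extF ψ = trans (sumAt-cong k (sumOver-sumAt-comm L i extF) ψ) (sumAt-comm k i (sumOver-ext L extF) ψ)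

  -- The inner sum is moved outwards until it meets the occurrence of `i` in `L`. By then it no
  -- longer depends on that coordinate, so summing again only multiplies by `r`.
  sumOver-sumAt-absorb : ∀ {L i F} → Extensional F → i ∈ L → ∀ ψ → sumOver L (sumAt i F) ψ ≡ r * sumOver L F ψ
  sumOver-sumAt-absorb {k ∷ L} extF (here refl) ψ = trans
    (sumAt-cong k (sumOver-sumAt-comm L k extF) ψ)
    (sumAt-independent (sumAt-makes-independent k (sumOver-ext L extF)) ψ)
  sumOver-sumAt-absorb {k ∷ L} {F = F} extF (there i∈L) ψ = trans
    (sumAt-cong k (sumOver-sumAt-absorb extF i∈L) ψ) (sumAt-scale k r (sumOver L F) ψ)

  sumOver-sumOver-absorb : ∀ {L F} cs → Extensional F → (∀ {c} → c ∈ cs → c ∈ L) →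
    ∀ ψ → sumOver L (sumOver cs F) ψ ≡ r ^ length cs * sumOver L F ψ
  sumOver-sumOver-absorb         []       extF cs⊆L ψ = sym (*-identityˡ _)
  sumOver-sumOver-absorb {L} {F} (c ∷ cs) extF cs⊆L ψ = begin
    sumOver L (sumAt c (sumOver cs F)) ψ  ≡⟨ sumOver-sumAt-absorb (sumOver-ext cs extF) (cs⊆L (here refl)) ψ ⟩
    r * sumOver L (sumOver cs F) ψ        ≡⟨ cong (r *_) (sumOver-sumOver-absorb cs extF (cs⊆L ∘ there) ψ) ⟩
    r * (r ^ length cs * sumOver L F ψ)   ≡⟨ *-assoc r _ _ ⟨
    r ^ length (c ∷ cs) * sumOver L F ψ   ∎
    where open ≡-Reasoning

  sumOver-const : ∀ L c ψ → sumOver L (λ _ → c) ψ ≡ r ^ length L * c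
  sumOver-const []      c ψ = sym (*-identityˡ c)
  sumOver-const (i ∷ L) c ψ = trans (sumAt-cong i (sumOver-const L c) ψ)
    (trans (∑-Fin-const _) (sym (*-assoc r (r ^ length L) c)))

  -- Summing over `L` never changes a coordinate outside `L`. In `sumOver-tuple` this freezes the
  -- colour of the head while the tail is summed.
  sumOver-cong-fixing : ∀ L {c} {F G} ψ → c ∉ L → (∀ ψ′ → ψ′ c ≡ ψ c → F ψ′ ≡ G ψ′) → sumOver L F ψ ≡ sumOver L G ψ
  sumOver-cong-fixing []      ψ c∉L F≗G = F≗G ψ refl
  sumOver-cong-fixing (i ∷ L) ψ c∉L F≗G = ∑-cong (allFin r) λ x →
    sumOver-cong-fixing L (ψ [ i ≔ x ]) (c∉L ∘ there) λ ψ′ eq →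
      F≗G ψ′ (trans eq (update-other ψ x (c∉L ∘ here ∘ sym)))

  sumOver-tuple : ∀ cs → Unique cs → (f : List (Fin r) → ℕ) → ∀ ψ →
    sumOver cs (λ ψ′ → f (map ψ′ cs)) ψ ≡ ∑ (allTuples r (length cs)) f
  sumOver-tuple []       _           f ψ = sym (+-identityʳ _)
  sumOver-tuple (c ∷ cs) (c∉cs ∷ uq) f ψ = begin
    ∑ (allFin r) (λ x → sumOver cs (λ ψ′ → f (ψ′ c ∷ map ψ′ cs)) (ψ [ c ≔ x ]))
      ≡⟨ ∑-cong (allFin r) (λ x → sumOver-cong-fixing cs (ψ [ c ≔ x ]) (λ c∈cs → All.lookup c∉cs c∈cs refl)
           λ ψ′ eq → cong (λ y → f (y ∷ map ψ′ cs)) (trans eq (update-same ψ c x))) ⟩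
    ∑ (allFin r) (λ x → sumOver cs (λ ψ′ → f (x ∷ map ψ′ cs)) (ψ [ c ≔ x ]))
      ≡⟨ ∑-cong (allFin r) (λ x → sumOver-tuple cs uq (f ∘ (x ∷_)) (ψ [ c ≔ x ])) ⟩
    ∑ (allFin r) (λ x → ∑ (allTuples r (length cs)) (f ∘ (x ∷_)))
      ≡⟨ ∑-cong (allFin r) (λ x → ∑-map (allTuples r (length cs)) (x ∷_) f) ⟨
    ∑ (allFin r) (λ x → ∑ (map (x ∷_) (allTuples r (length cs))) f)
      ≡⟨ ∑-concatMap (allFin r) _ f ⟨
    ∑ (allTuples r (length (c ∷ cs))) f ∎
    where open ≡-Reasoning

  tuple-ext : ∀ cs (f : List (Fin r) → ℕ) → Extensional (λ ψ → f (map ψ cs))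
  tuple-ext cs f ψ≗ψ′ = cong f (map-cong ψ≗ψ′ cs)

  tuple-independent : ∀ {i} cs (f : List (Fin r) → ℕ) → i ∉ cs → Independent i (λ ψ → f (map ψ cs))
  tuple-independent cs f i∉cs ψ x = cong f (map-cong-local
    (All.tabulate λ {c} c∈cs → update-other ψ x λ { refl → i∉cs c∈cs }))

  -- The colours at distinct coordinates form a uniformly distributed tuple. Redrawing `cs` once
  -- more inside the sum over `L` exposes that tuple, at the cost of the factor on the left.
  sumOver-tuple-mean : ∀ L cs → Unique cs → (∀ {c} → c ∈ cs → c ∈ L) → (f : List (Fin r) → ℕ) → ∀ ψ →
    r ^ length cs * sumOver L (λ ψ′ → f (map ψ′ cs)) ψ ≡ r ^ length L * ∑ (allTuples r (length cs)) f
  sumOver-tuple-mean L cs uq cs⊆L f ψ = begin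
    r ^ length cs * sumOver L (λ ψ′ → f (map ψ′ cs)) ψ  ≡⟨ sumOver-sumOver-absorb cs (tuple-ext cs f) cs⊆L ψ ⟨
    sumOver L (sumOver cs (λ ψ′ → f (map ψ′ cs))) ψ     ≡⟨ sumOver-cong L (sumOver-tuple cs uq f) ψ ⟩
    sumOver L (λ _ → ∑ (allTuples r (length cs)) f) ψ   ≡⟨ sumOver-const L _ ψ ⟩
    r ^ length L * ∑ (allTuples r (length cs)) f        ∎
    where open ≡-Reasoning

  sumOver-∑ : ∀ L (xs : List A) (F : A → Colouring → ℕ) ψ →
    sumOver L (λ ψ′ → ∑ xs (λ x → F x ψ′)) ψ ≡ ∑ xs (λ x → sumOver L (F x) ψ)
  sumOver-∑ []      xs F ψ = refl
  sumOver-∑ (i ∷ L) xs F ψ = trans (sumAt-cong i (sumOver-∑ L xs F) ψ) (∑-swap (allFin r) xs _)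

  -- The method of conditional expectations: some colour of the first coordinate keeps the remaining
  -- mean below `c`, and the search continues from there.
  sumOver-<⇒∃ : ∀ L F c ψ → sumOver L F ψ < r ^ length L * c → ∃ λ ψ′ → F ψ′ < c
  sumOver-<⇒∃ []      F c ψ lt = ψ , subst (F ψ <_) (*-identityˡ c) lt
  sumOver-<⇒∃ (i ∷ L) F c ψ lt with ∑-<⇒∃ (allFin r) _ (r ^ length L * c)
    (subst (sumAt i (sumOver L F) ψ <_) (trans (*-assoc r _ c) (cong (_* (r ^ length L * c)) (sym length-allFin))) lt)
  ... | x , lt′ = sumOver-<⇒∃ L F c (ψ [ i ≔ x ]) lt′

  -- Expectations of products of independent factors

  sumAt-* : ∀ i G F → Independent i G → ∀ ψ → sumAt i (λ ψ′ → G ψ′ * F ψ′) ψ ≡ G ψ * sumAt i F ψ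
  sumAt-* i G F ind ψ = trans (∑-cong (allFin r) λ x → cong (_* F (ψ [ i ≔ x ])) (ind ψ x))
    (*-distribˡ-∑ (allFin r) (G ψ) _)

  r*sumAt-* : ∀ i {G F} → Independent i G ⊎ Independent i F → ∀ ψ →
    r * sumAt i (λ ψ′ → G ψ′ * F ψ′) ψ ≡ sumAt i G ψ * sumAt i F ψ
  r*sumAt-* i {G} {F} (inj₁ ind) ψ = begin
    r * sumAt i (λ ψ′ → G ψ′ * F ψ′) ψ  ≡⟨ cong (r *_) (sumAt-* i G F ind ψ) ⟩
    r * (G ψ * sumAt i F ψ)             ≡⟨ *-assoc r _ _ ⟨
    r * G ψ * sumAt i F ψ               ≡⟨ cong (_* sumAt i F ψ) (sumAt-independent ind ψ) ⟨
    sumAt i G ψ * sumAt i F ψ           ∎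
    where open ≡-Reasoning
  r*sumAt-* i {G} {F} (inj₂ ind) ψ = begin
    r * sumAt i (λ ψ′ → G ψ′ * F ψ′) ψ  ≡⟨ cong (r *_) (sumAt-cong i (λ ψ′ → *-comm (G ψ′) (F ψ′)) ψ) ⟩
    r * sumAt i (λ ψ′ → F ψ′ * G ψ′) ψ  ≡⟨ r*sumAt-* i {F} {G} (inj₁ ind) ψ ⟩
    sumAt i F ψ * sumAt i G ψ           ≡⟨ *-comm (sumAt i F ψ) (sumAt i G ψ) ⟩
    sumAt i G ψ * sumAt i F ψ           ∎
    where open ≡-Reasoning

  -- When no coordinate influences both factors, the mean of the product is the product of the
  -- means. This holds for a single coordinate by `r*sumAt-*`, and summing out other coordinates
  -- creates no new dependence.
  sumOver-* : ∀ L {G F} → Extensional G → Extensional F → (∀ i → Independent i G ⊎ Independent i F) → ∀ ψ →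
    r ^ length L * sumOver L (λ ψ′ → G ψ′ * F ψ′) ψ ≡ sumOver L G ψ * sumOver L F ψ
  sumOver-* []              extG extF ind ψ = *-identityˡ _
  sumOver-* (i ∷ L) {G} {F} extG extF ind ψ = begin
    r * r ^ length L * sumAt i (sumOver L GF) ψ             ≡⟨ *-assoc r _ _ ⟩
    r * (r ^ length L * sumAt i (sumOver L GF) ψ)           ≡⟨ cong (r *_) (sumAt-scale i (r ^ length L) (sumOver L GF) ψ) ⟨
    r * sumAt i (λ ψ′ → r ^ length L * sumOver L GF ψ′) ψ   ≡⟨ cong (r *_) (sumAt-cong i (sumOver-* L extG extF ind) ψ) ⟩
    r * sumAt i (λ ψ′ → sumOver L G ψ′ * sumOver L F ψ′) ψ  ≡⟨ r*sumAt-* i (ind′ (ind i)) ψ ⟩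
    sumAt i (sumOver L G) ψ * sumAt i (sumOver L F) ψ       ∎
    where
    open ≡-Reasoning
    GF : Colouring → ℕ
    GF ψ′ = G ψ′ * F ψ′
    ind′ : Independent i G ⊎ Independent i F → Independent i (sumOver L G) ⊎ Independent i (sumOver L F)
    ind′ (inj₁ p) = inj₁ (sumOver-preserves-independent L extG p)
    ind′ (inj₂ p) = inj₂ (sumOver-preserves-independent L extF p)

  ∏-independent : ∀ {i} {xs : List A} {w : A → Colouring → ℕ} → All (λ x → Independent i (w x)) xs →
    Independent i (λ ψ → ∏ xs (λ x → w x ψ))
  ∏-independent []        ψ x = refl
  ∏-independent (p ∷ ps)  ψ x = cong₂ _*_ (p ψ x) (∏-independent ps ψ x)

  -- For a fixed coordinate, `P` says that the head factor ignores it and `Q` that a later factor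
  -- does. The pairwise alternatives thus become one alternative between the head and the whole
  -- remaining product.
  split-⊎ : ∀ {P : Set} {Q : A → Set} {xs} → All (λ x → P ⊎ Q x) xs → P ⊎ All Q xs
  split-⊎ []             = inj₂ []
  split-⊎ (inj₁ p ∷ _)   = inj₁ p
  split-⊎ (inj₂ q ∷ pqs) with split-⊎ pqs
  ... | inj₁ p  = inj₁ p
  ... | inj₂ qs = inj₂ (q ∷ qs)

  -- A pairwise condition suffices because it concerns shared coordinates: a factor sharing none
  -- with each later factor shares none with their product. Mere pairwise stochastic independence
  -- would not give this.
  sumOver-∏-≤ : .{{NonZero r}} → ∀ L {xs : List A} {w : A → Colouring → ℕ} {D} → (∀ x → Extensional (w x)) →
    (∀ x ψ → sumOver L (w x) ψ ≤ r ^ length L * D) →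
    AllPairs (λ x y → ∀ i → Independent i (w x) ⊎ Independent i (w y)) xs →
    ∀ ψ → sumOver L (λ ψ′ → ∏ xs (λ x → w x ψ′)) ψ ≤ r ^ length L * D ^ length xs
  sumOver-∏-≤ L ext mean [] ψ = ≤-reflexive (sumOver-const L 1 ψ)
  sumOver-∏-≤ L {x ∷ xs} {w} {D} ext mean (ind ∷ inds) ψ = *-cancelˡ-≤ R {{m^n≢0 r (length L)}} (begin
    R * sumOver L (λ ψ′ → w x ψ′ * Πxs ψ′) ψ      ≡⟨ sumOver-* L (ext x) (λ eq → ∏-cong xs λ y → ext y eq)
                                                 (λ i → Sum.map₂ ∏-independent (split-⊎ (All.map (λ f → f i) ind))) ψ ⟩
    sumOver L (w x) ψ * sumOver L Πxs ψ  ≤⟨ *-mono-≤ (mean x ψ) (sumOver-∏-≤ L ext mean inds ψ) ⟩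
    R * D * (R * D ^ length xs)          ≡⟨ rearrange R D (D ^ length xs) ⟩
    R * (R * (D * D ^ length xs))        ∎)
    where
    open ≤-Reasoning
    R = r ^ length L
    Πxs : Colouring → ℕ
    Πxs ψ′ = ∏ xs (λ y → w y ψ′)
    rearrange : ∀ a b c → a * b * (a * c) ≡ a * (a * (b * c))
    rearrange = solve-∀

-- Subsets and their boundaries

_≟ˢ_ : DecidableEquality (Subset n)
_≟ˢ_ = ≡-dec Bool._≟_

vertexSum : Subset n → ℕ
vertexSum e = ∑ (elements e) toℕ

boundary : Subset n → List (Subset n)
boundary e = map (e without_) (elements e)

length-elements : (e : Subset n) → length (elements e) ≡ ∣ e ∣
length-elements []            = refl
length-elements (inside  ∷ e) = cong suc (trans (length-map suc (elements e)) (length-elements e))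
length-elements (outside ∷ e) = trans (length-map suc (elements e)) (length-elements e)

length-boundary : (e : Subset n) → length (boundary e) ≡ ∣ e ∣
length-boundary e = trans (length-map (e without_) (elements e)) (length-elements e)

∈-elements⁻ : (e : Subset n) → ∀ {i} → i ∈ elements e → i ∈ˢ e
∈-elements⁻ (inside  ∷ e) (here refl) = here
∈-elements⁻ (inside  ∷ e) (there i∈)  with ∈-map⁻ suc i∈
... | _ , i′∈ , refl = there (∈-elements⁻ e i′∈)
∈-elements⁻ (outside ∷ e) i∈          with ∈-map⁻ suc i∈
... | _ , i′∈ , refl = there (∈-elements⁻ e i′∈)

elements-unique : (e : Subset n) → Unique (elements e)
elements-unique []            = []
elements-unique (inside  ∷ e) =
  All.tabulate (λ i∈ 0≡i → case (∈-map⁻ suc (subst (_∈ _) (sym 0≡i) i∈)))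
  ∷ Unique.map⁺ Fin.suc-injective (elements-unique e)
  where
  case : ∃ (λ x → x ∈ elements e × zero ≡ suc x) → _
  case (_ , _ , ())
elements-unique (outside ∷ e) = Unique.map⁺ Fin.suc-injective (elements-unique e)

∑-elements-without : ∀ {e : Subset n} {i} → i ∈ˢ e → (f : Fin n → ℕ) →
  ∑ (elements e) f ≡ f i + ∑ (elements (e without i)) f
∑-elements-without {e = inside ∷ e}  {zero}  here       f =
  -- Removing `zero` leaves the tail as a difference with the empty set, which is `e` only up to
  -- `p─⊥≡p`.
  cong (λ s → f zero + ∑ (map suc (elements s)) f) (sym (p─⊥≡p e))
∑-elements-without {e = b ∷ e} {suc i} (there i∈) f = extend b
  where
  open ≡-Reasoning
  shifted : ∑ (map suc (elements e)) f ≡ f (suc i) + ∑ (map suc (elements (e without i))) f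
  shifted = begin
    ∑ (map suc (elements e)) f                          ≡⟨ ∑-map (elements e) suc f ⟩
    ∑ (elements e) (f ∘ suc)                            ≡⟨ ∑-elements-without i∈ (f ∘ suc) ⟩
    f (suc i) + ∑ (elements (e without i)) (f ∘ suc)    ≡⟨ cong (f (suc i) +_) (∑-map (elements (e without i)) suc f) ⟨
    f (suc i) + ∑ (map suc (elements (e without i))) f  ∎
  rearrange : ∀ a b c → a + (b + c) ≡ b + (a + c)
  rearrange = solve-∀
  extend : ∀ b → ∑ (elements (b ∷ e)) f ≡ f (suc i) + ∑ (elements ((b ∷ e) without (suc i))) f
  extend outside = shifted
  extend inside  = trans (cong (f zero +_) shifted) (rearrange (f zero) (f (suc i)) _)

vertexSum-≤ : (e : Subset n) → vertexSum e ≤ ∣ e ∣ * n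
vertexSum-≤ {n} e = begin
  ∑ (elements e) toℕ        ≤⟨ ∑-mono-≤ (elements e) (λ i → <⇒≤ (Fin.toℕ<n i)) ⟩
  ∑ (elements e) (λ _ → n)  ≡⟨ ∑-const (elements e) n ⟩
  length (elements e) * n   ≡⟨ cong (_* n) (length-elements e) ⟩
  ∣ e ∣ * n                 ∎
  where open ≤-Reasoning

-- The vertex removed is the difference of the two vertex sums.
removed-vertex-≡ : ∀ {e e′ : Subset n} {i i′} → vertexSum e ≡ vertexSum e′ → i ∈ˢ e → i′ ∈ˢ e′ →
  e without i ≡ e′ without i′ → i ≡ i′
removed-vertex-≡ {e = e} {e′} {i} {i′} sum≡ i∈e i′∈e′ eq = Fin.toℕ-injective (+-cancelʳ-≡ (vertexSum (e without i)) _ _ (begin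
  toℕ i  + vertexSum (e  without i)   ≡⟨ ∑-elements-without i∈e toℕ ⟨
  vertexSum e                         ≡⟨ sum≡ ⟩
  vertexSum e′                        ≡⟨ ∑-elements-without i′∈e′ toℕ ⟩
  toℕ i′ + vertexSum (e′ without i′)  ≡⟨ cong (λ s → toℕ i′ + vertexSum s) eq ⟨
  toℕ i′ + vertexSum (e  without i)   ∎))
  where open ≡-Reasoning

without-injective : ∀ {e e′ : Subset n} {i} → i ∈ˢ e → i ∈ˢ e′ → e without i ≡ e′ without i → e ≡ e′
without-injective {e = _ ∷ e} {_ ∷ e′} here here eq =
  cong (inside ∷_) (trans (sym (p─⊥≡p e)) (trans (∷-injectiveʳ eq) (p─⊥≡p e′)))
without-injective (there i∈e) (there i∈e′) eq =
  cong₂ _∷_ (∷-injectiveˡ eq) (without-injective i∈e i∈e′ (∷-injectiveʳ eq))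

boundary-disjoint : ∀ {e e′ : Subset n} {s} → vertexSum e ≡ vertexSum e′ →
  s ∈ boundary e → s ∈ boundary e′ → e ≡ e′
boundary-disjoint {e = e} {e′} sum≡ s∈∂e s∈∂e′ with ∈-map⁻ (e without_) s∈∂e | ∈-map⁻ (e′ without_) s∈∂e′
... | i , i∈e , refl | i′ , i′∈e′ , eq with removed-vertex-≡ sum≡ (∈-elements⁻ e i∈e) (∈-elements⁻ e′ i′∈e′) eq
... | refl = without-injective (∈-elements⁻ e i∈e) (∈-elements⁻ e′ i′∈e′) eq

-- Injectivity is asked on the list only, since `e without_` is injective on the elements of `e` but
-- sends every other vertex to `e` itself.
unique-map-local : ∀ {f : A → B} {xs} → (∀ {x y} → x ∈ xs → y ∈ xs → f x ≡ f y → x ≡ y) →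
  Unique xs → Unique (map f xs)
unique-map-local inj []       = []
unique-map-local {f = f} inj (x∉xs ∷ uq) = All.tabulate fresh ∷ unique-map-local (λ x∈ y∈ → inj (there x∈) (there y∈)) uq
  where
  fresh : ∀ {y} → y ∈ map f _ → f _ ≢ y
  fresh y∈ fx≡y with ∈-map⁻ f y∈
  ... | x′ , x′∈ , refl = All.lookup x∉xs x′∈ (inj (here refl) (there x′∈) fx≡y)

boundary-unique : (e : Subset n) → Unique (boundary e)
boundary-unique e = unique-map-local
  (λ i∈ i′∈ → removed-vertex-≡ refl (∈-elements⁻ e i∈) (∈-elements⁻ e i′∈)) (elements-unique e)

∈-allSubsets : (e : Subset n) → e ∈ allSubsets n
∈-allSubsets         []            = here refl
∈-allSubsets         (inside  ∷ e) = ∈-++⁺ˡ (∈-map⁺ (inside ∷_) (∈-allSubsets e))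
∈-allSubsets {suc n} (outside ∷ e) = ∈-++⁺ʳ (map (inside ∷_) (allSubsets n)) (∈-map⁺ (outside ∷_) (∈-allSubsets e))

allSubsets-unique : ∀ n → Unique (allSubsets n)
allSubsets-unique zero    = [] ∷ []
allSubsets-unique (suc n) = Unique.++⁺
  (Unique.map⁺ ∷-injectiveʳ (allSubsets-unique n)) (Unique.map⁺ ∷-injectiveʳ (allSubsets-unique n))
  λ { (s∈ , s∈′) → disjoint (∈-map⁻ (inside ∷_) s∈) (∈-map⁻ (outside ∷_) s∈′) }
  where
  disjoint : ∀ {s : Subset (suc n)} → ∃ (λ t → t ∈ allSubsets n × s ≡ inside ∷ t) →
    ∃ (λ t → t ∈ allSubsets n × s ≡ outside ∷ t) → _
  disjoint (_ , _ , refl) (_ , _ , ())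

-- Counting

indicator : Bool → ℕ
indicator b = if b then 1 else 0

count≡∑ : ∀ (p : A → Bool) xs → count p xs ≡ ∑ xs (indicator ∘ p)
count≡∑ p []       = refl
count≡∑ p (x ∷ xs) with p x
... | true  = cong suc (count≡∑ p xs)
... | false = count≡∑ p xs

count-cong : ∀ {p q : A → Bool} xs → (∀ x → p x ≡ q x) → count p xs ≡ count q xs
count-cong {p = p} {q} xs p≗q = trans (count≡∑ p xs)
  (trans (∑-cong xs (cong indicator ∘ p≗q)) (sym (count≡∑ q xs)))

count-filter : ∀ (p q : A → Bool) xs → count p (filter (λ x → q x Bool.≟ true) xs) ≡ count (λ x → q x ∧ p x) xs
count-filter p q []       = refl
count-filter p q (x ∷ xs) with q x
... | false = count-filter p q xs
... | true  with p x
...   | true  = cong suc (count-filter p q xs)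
...   | false = count-filter p q xs

∑-upTo-indicator : ∀ {k N} → k < N → ∑ (upTo N) (λ c → indicator (k ≡ᵇ c)) ≡ 1
∑-upTo-indicator {k} {suc N} k<1+N = trans
  (cong (λ cs → indicator (k ≡ᵇ 0) + ∑ cs (λ c → indicator (k ≡ᵇ c))) (sym (map-upTo suc N)))
  (trans (cong (indicator (k ≡ᵇ 0) +_) (∑-map (upTo N) suc _)) (step k k<1+N))
  where
  step : ∀ k → k < suc N → indicator (k ≡ᵇ 0) + ∑ (upTo N) (λ c → indicator (k ≡ᵇ suc c)) ≡ 1
  step zero    _         = cong suc (trans (∑-const (upTo N) 0) (*-zeroʳ (length (upTo N))))
  step (suc k) (s≤s k<N) = ∑-upTo-indicator k<N

count-partition : ∀ (p : A → Bool) (key : A → ℕ) N xs → (∀ x → p x ≡ true → key x < N) →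
  count p xs ≡ ∑ (upTo N) (λ c → count (λ x → p x ∧ (key x ≡ᵇ c)) xs)
count-partition p key N xs bounded = begin
  count p xs                                                      ≡⟨ count≡∑ p xs ⟩
  ∑ xs (indicator ∘ p)                                            ≡⟨ ∑-cong xs (λ x → split x (p x) refl) ⟩
  ∑ xs (λ x → ∑ (upTo N) (λ c → indicator (p x ∧ (key x ≡ᵇ c))))  ≡⟨ ∑-swap xs (upTo N) _ ⟩
  ∑ (upTo N) (λ c → ∑ xs (λ x → indicator (p x ∧ (key x ≡ᵇ c))))  ≡⟨ ∑-cong (upTo N) (λ c → count≡∑ _ xs) ⟨
  ∑ (upTo N) (λ c → count (λ x → p x ∧ (key x ≡ᵇ c)) xs)          ∎
  where
  open ≡-Reasoning
  split : ∀ x b → p x ≡ b → indicator b ≡ ∑ (upTo N) (λ c → indicator (b ∧ (key x ≡ᵇ c)))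
  split x true  px = sym (∑-upTo-indicator (bounded x px))
  split x false px = sym (trans (∑-const (upTo N) 0) (*-zeroʳ (length (upTo N))))

count+count-not : ∀ (P : A → Bool) xs → count P xs + count (not ∘ P) xs ≡ length xs
count+count-not P []       = refl
count+count-not P (x ∷ xs) with P x
... | true  = cong suc (count+count-not P xs)
... | false = trans (+-suc (count P xs) _) (cong suc (count+count-not P xs))

∑-if : ∀ (P : A → Bool) a b xs →
  ∑ xs (λ x → if P x then a else b) ≡ count P xs * a + count (not ∘ P) xs * b
∑-if P a b []       = refl
∑-if P a b (x ∷ xs) with P x
... | true  = trans (cong (a +_) (∑-if P a b xs)) (sym (+-assoc a _ _))
... | false = trans (cong (b +_) (∑-if P a b xs)) (rearrange b (count P xs * a) (count (not ∘ P) xs * b))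
  where
  rearrange : ∀ b x y → b + (x + y) ≡ x + (b + y)
  rearrange = solve-∀

length-allTuples : ∀ r k → length (allTuples r k) ≡ r ^ k
length-allTuples r zero    = refl
length-allTuples r (suc k) = begin
  length (allTuples r (suc k))                                   ≡⟨ length≡∑1 (allTuples r (suc k)) ⟩
  ∑ (allTuples r (suc k)) (λ _ → 1)                              ≡⟨ ∑-concatMap (allFin r) _ _ ⟩
  ∑ (allFin r) (λ x → ∑ (map (x ∷_) (allTuples r k)) (λ _ → 1))  ≡⟨ ∑-cong (allFin r) (λ x → trans
    (∑-map (allTuples r k) (x ∷_) _) (trans (sym (length≡∑1 (allTuples r k))) (length-allTuples r k))) ⟩
  ∑ (allFin r) (λ _ → r ^ k)  ≡⟨ ∑-const (allFin r) (r ^ k) ⟩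
  length (allFin r) * r ^ k   ≡⟨ cong (_* r ^ k) (length-tabulate {n = r} id) ⟩
  r * r ^ k                   ∎
  where
  open ≡-Reasoning
  length≡∑1 : ∀ {A : Set} (xs : List A) → length xs ≡ ∑ xs (λ _ → 1)
  length≡∑1 xs = trans (sym (*-identityʳ _)) (sym (∑-const xs 1))

count-∧-split : ∀ (p q : A → Bool) xs →
  count (λ x → p x ∧ q x) xs + count (λ x → p x ∧ not (q x)) xs ≡ count p xs
count-∧-split p q []       = refl
count-∧-split p q (x ∷ xs) with p x
... | false = count-∧-split p q xs
... | true  with q x
...   | true  = cong suc (count-∧-split p q xs)
...   | false = trans (+-suc (count (λ x → p x ∧ q x) xs) _) (cong suc (count-∧-split p q xs))

∏-if-if : ∀ (p q : A → Bool) a b d xs →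
  ∏ xs (λ x → if p x then (if q x then a else b) else d) ≡
    a ^ count (λ x → p x ∧ q x) xs * b ^ count (λ x → p x ∧ not (q x)) xs * d ^ count (not ∘ p) xs
∏-if-if p q a b d []       = refl
∏-if-if p q a b d (x ∷ xs) with p x
... | false = trans (cong (d *_) (∏-if-if p q a b d xs)) (rearrange d (a ^ count (λ x → p x ∧ q x) xs) (b ^ count (λ x → p x ∧ not (q x)) xs) (d ^ count (not ∘ p) xs))
  where
  rearrange : ∀ d x y z → d * (x * y * z) ≡ x * y * (d * z)
  rearrange = solve-∀
... | true  with q x
...   | true  = trans (cong (a *_) (∏-if-if p q a b d xs)) (rearrange a (a ^ count (λ x → p x ∧ q x) xs) (b ^ count (λ x → p x ∧ not (q x)) xs) (d ^ count (not ∘ p) xs))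
  where
  rearrange : ∀ a x y z → a * (x * y * z) ≡ a * x * y * z
  rearrange = solve-∀
...   | false = trans (cong (b *_) (∏-if-if p q a b d xs)) (rearrange b (a ^ count (λ x → p x ∧ q x) xs) (b ^ count (λ x → p x ∧ not (q x)) xs) (d ^ count (not ∘ p) xs))
  where
  rearrange : ∀ b x y z → b * (x * y * z) ≡ x * (b * y) * z
  rearrange = solve-∀

-- Counting j-sets and enumerating j-graphs

ofSize : ℕ → Subset n → Bool
ofSize j s = ∣ s ∣ ≡ᵇ j

∑-allSubsets : ∀ n (f : Subset (suc n) → ℕ) →
  ∑ (allSubsets (suc n)) f ≡ ∑ (allSubsets n) (f ∘ (inside ∷_)) + ∑ (allSubsets n) (f ∘ (outside ∷_))
∑-allSubsets n f = trans (∑-++ (map (inside ∷_) (allSubsets n)) _ f)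
  (cong₂ _+_ (∑-map (allSubsets n) (inside ∷_) f) (∑-map (allSubsets n) (outside ∷_) f))

-- Pascal's rule together with n^j + n^(j+1) = (n+1) n^j. Only the order n^j of the binomial
-- coefficient matters later.
∑-ofSize-≤ : ∀ n j → ∑ (allSubsets n) (indicator ∘ ofSize j) ≤ n ^ j
∑-ofSize-≤ zero    zero    = ≤-refl
∑-ofSize-≤ zero    (suc j) = z≤n
∑-ofSize-≤ (suc n) zero    = begin
  ∑ (allSubsets (suc n)) (indicator ∘ ofSize 0)                         ≡⟨ ∑-allSubsets n _ ⟩
  ∑ (allSubsets n) (λ _ → 0) + ∑ (allSubsets n) (indicator ∘ ofSize 0)  ≡⟨ cong (_+ ∑ (allSubsets n) (indicator ∘ ofSize 0))
                                                                                    (trans (∑-const (allSubsets n) 0) (*-zeroʳ (length (allSubsets n)))) ⟩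
  ∑ (allSubsets n) (indicator ∘ ofSize 0)  ≤⟨ ∑-ofSize-≤ n zero ⟩
  1                                        ∎
  where open ≤-Reasoning
∑-ofSize-≤ (suc n) (suc j) = begin
  ∑ (allSubsets (suc n)) (indicator ∘ ofSize (suc j))                           ≡⟨ ∑-allSubsets n _ ⟩
  ∑ (allSubsets n) (indicator ∘ ofSize j) + ∑ (allSubsets n) (indicator ∘ ofSize (suc j))
                                                                                ≤⟨ +-mono-≤ (∑-ofSize-≤ n j) (∑-ofSize-≤ n (suc j)) ⟩
  suc n * n ^ j      ≤⟨ *-monoʳ-≤ (suc n) (^-monoˡ-≤ j (n≤1+n n)) ⟩
  suc n * suc n ^ j  ∎
  where open ≤-Reasoning

subsetsOfSize : ∀ n → ℕ → List (Subset n)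
subsetsOfSize n j = filter (λ s → ofSize j s Bool.≟ true) (allSubsets n)

length-subsetsOfSize-≤ : ∀ n j → length (subsetsOfSize n j) ≤ n ^ j
length-subsetsOfSize-≤ n j = subst (_≤ n ^ j) (sym (count≡∑ (ofSize j) (allSubsets n))) (∑-ofSize-≤ n j)

extend : Subset n → Bool → Graph n → Graph n
extend s b G t with s ≟ˢ t
... | yes _ = b
... | no  _ = G t

-- A `Graph` has a value on every subset, so listing all of them would cost 2^(2^n) events in the
-- union bound. Only the values on `J` vary here; all others are `false`.
graphsOn : List (Subset n) → List (Graph n)
graphsOn []      = (λ _ → false) ∷ []
graphsOn (s ∷ J) = map (extend s true) (graphsOn J) ++ map (extend s false) (graphsOn J)

length-graphsOn : (J : List (Subset n)) → length (graphsOn J) ≡ 2 ^ length J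
length-graphsOn []      = refl
length-graphsOn (s ∷ J) rewrite length-++ (map (extend s true) (graphsOn J)) {map (extend s false) (graphsOn J)}
  | length-map (extend s true) (graphsOn J) | length-map (extend s false) (graphsOn J)
  | length-graphsOn J = cong (2 ^ length J +_) (sym (+-identityʳ _))

graphsOn-complete : (G : Graph n) (J : List (Subset n)) → ∃ λ G′ → G′ ∈ graphsOn J × (∀ {t} → t ∈ J → G′ t ≡ G t)
graphsOn-complete G []      = (λ _ → false) , here refl , λ ()
graphsOn-complete G (s ∷ J) with graphsOn-complete G J
... | G′ , G′∈ , agree = extend s (G s) G′ , extend-∈ (G s) , agree′
  where
  extend-∈ : ∀ b → extend s b G′ ∈ graphsOn (s ∷ J)
  extend-∈ true  = ∈-++⁺ˡ (∈-map⁺ (extend s true) G′∈)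
  extend-∈ false = ∈-++⁺ʳ (map (extend s true) (graphsOn J)) (∈-map⁺ (extend s false) G′∈)
  agree′ : ∀ {t} → t ∈ s ∷ J → extend s (G s) G′ t ≡ G t
  agree′ {t} t∈ with s ≟ˢ t | t∈
  ... | yes refl | _         = refl
  ... | no  s≢t  | here refl = contradiction refl s≢t
  ... | no  _    | there t∈J = agree t∈J

-- Kk j k G is definitionally the filter of allSubsets by this predicate (local to Kk in the definition).
isClique : ℕ → ℕ → Graph n → Subset n → Bool
isClique {n} j k G s = ofSize k s ∧ allᵇ (λ t → not (subsetᵇ t s ∧ ofSize j t) ∨ G t) (allSubsets n)

allᵇ-cong : ∀ {p q : A → Bool} xs → (∀ x → p x ≡ q x) → allᵇ p xs ≡ allᵇ q xs
allᵇ-cong []       p≗q = refl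
allᵇ-cong (x ∷ xs) p≗q = cong₂ _∧_ (p≗q x) (allᵇ-cong xs p≗q)

-- The clique test reads `G` behind a guard that holds only for sets of size `j`. This makes the
-- short list `graphsOn` sufficient for all graphs.
isClique-cong : ∀ j k {G G′ : Graph n} → (∀ {t} → t ∈ subsetsOfSize n j → G t ≡ G′ t) →
  ∀ s → isClique j k G s ≡ isClique j k G′ s
isClique-cong {n} j k {G} {G′} agree s = cong (ofSize k s ∧_) (allᵇ-cong (allSubsets n) λ t → pointwise t (ofSize j t) refl)
  where
  pointwise : ∀ t b → ofSize j t ≡ b → not (subsetᵇ t s ∧ b) ∨ G t ≡ not (subsetᵇ t s ∧ b) ∨ G′ t
  pointwise t true  eq = cong (not (subsetᵇ t s ∧ true) ∨_) (agree (∈-filter⁺ (λ s → ofSize j s Bool.≟ true) (∈-allSubsets t) eq))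
  pointwise t false eq rewrite ∧-zeroʳ (subsetᵇ t s) = refl

-- Exponential estimates

-- Bernoulli's inequality (1 + 1/q)^g ≥ 1 + g/q, cleared of denominators.
bernoulli-≤ : ∀ q g → q ^ g * (q + g) ≤ suc q ^ g * q
bernoulli-≤ q zero    = ≤-reflexive (cong (_+ 0) (+-identityʳ q))
bernoulli-≤ q (suc g) = begin
  q * x * (q + suc g)          ≤⟨ m≤m+n _ (x * g) ⟩
  q * x * (q + suc g) + x * g  ≡⟨ expand q x g ⟩
  suc q * (x * (q + g))        ≤⟨ *-monoʳ-≤ (suc q) (bernoulli-≤ q g) ⟩
  suc q * (suc q ^ g * q)      ≡⟨ *-assoc (suc q) (suc q ^ g) q ⟨
  suc q * suc q ^ g * q        ∎
  where
  open ≤-Reasoning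
  x = q ^ g
  expand : ∀ q x g → q * x * (q + suc g) + x * g ≡ suc q * (x * (q + g))
  expand = solve-∀

-- The value is 2^b - 1 - b, the sum of the binomial coefficients of `b` from index 2 on. The
-- recursion multiplies 1 + b/q + C/q² by 1 + 1/q and raises the term C/q³ to C/q².
secondOrder : ℕ → ℕ
secondOrder zero    = 0
secondOrder (suc b) = b + 2 * secondOrder b

-- (1 + 1/q)^b ≤ 1 + b/q + C/q², cleared of denominators.
binomial-≤ : ∀ p b → let q = suc p in
  suc q ^ b * (q * q) ≤ q ^ b * (q * q + b * q + secondOrder b)
binomial-≤ p zero    = ≤-reflexive (trivial (suc p))
  where
  trivial : ∀ q → 1 * (q * q) ≡ 1 * (q * q + 0 * q + 0)
  trivial = solve-∀
binomial-≤ p (suc b) = begin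
  suc q * y * (q * q)                              ≡⟨ *-assoc (suc q) y (q * q) ⟩
  suc q * (y * (q * q))                            ≤⟨ *-monoʳ-≤ (suc q) (binomial-≤ p b) ⟩
  suc q * (x * (q * q + b * q + C))                ≤⟨ m≤m+n _ (x * (p * C)) ⟩
  suc q * (x * (q * q + b * q + C)) + x * (p * C)  ≡⟨ expand p x b C ⟩
  q * x * (q * q + suc b * q + (b + 2 * C))        ∎
  where
  open ≤-Reasoning
  q = suc p
  x = q ^ b
  y = suc q ^ b
  C = secondOrder b
  expand : ∀ p x b C → let q = suc p in
    suc q * (x * (q * q + b * q + C)) + x * (p * C) ≡ q * x * (q * q + suc b * q + (b + 2 * C))
  expand = solve-∀

-- Weighting the a good outcomes by 1 and the b bad ones by z^β, the mean weight is at most z^γ for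
-- z = 1 + 1/q close to 1, because the derivatives at z = 1 compare strictly.
mean-weight-≤ : ∀ a b γ α → b * (γ + α) < (a + b) * γ → ∃ λ p → let q = suc p in
  a * q ^ (γ + α) + b * suc q ^ (γ + α) ≤ (a + b) * (suc q ^ γ * q ^ α)
mean-weight-≤ a b γ α lt = b * C , *-cancelʳ-≤ _ _ (q * q) (begin
  (a * x + b * y) * (q * q)                        ≡⟨ expand₁ a b x y q ⟩
  a * x * (q * q) + b * (y * (q * q))              ≤⟨ +-monoʳ-≤ (a * x * (q * q)) (*-monoʳ-≤ b (binomial-≤ (b * C) β)) ⟩
  a * x * (q * q) + b * (x * (q * q + β * q + C))  ≡⟨ expand₂ a b x q β C ⟩
  x * ((a + b) * (q * q) + (b * β * q + b * C))    ≤⟨ *-monoʳ-≤ x (+-monoʳ-≤ ((a + b) * (q * q)) gap) ⟩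
  x * ((a + b) * (q * q) + (a + b) * γ * q)        ≡⟨ cong (_* ((a + b) * (q * q) + (a + b) * γ * q)) (^-distribˡ-+-* q γ α) ⟩
  u * v * ((a + b) * (q * q) + (a + b) * γ * q)    ≡⟨ expand₃ (a + b) u v q γ ⟩
  (a + b) * v * q * (u * (q + γ))                  ≤⟨ *-monoʳ-≤ ((a + b) * v * q) (bernoulli-≤ q γ) ⟩
  (a + b) * v * q * (suc q ^ γ * q)                ≡⟨ expand₄ (a + b) v q (suc q ^ γ) ⟩
  (a + b) * (suc q ^ γ * v) * (q * q)              ∎)
  where
  open ≤-Reasoning
  β = γ + α
  C = secondOrder β
  -- With `q` above `b * C` the second-order term costs at most one unit of `q`, and the strict
  -- inequality `lt` between integers leaves a gap of at least one.
  q = suc (b * C)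
  x = q ^ β
  y = suc q ^ β
  u = q ^ γ
  v = q ^ α
  gap : b * β * q + b * C ≤ (a + b) * γ * q
  gap = begin
    b * β * q + b * C  ≤⟨ +-monoʳ-≤ (b * β * q) (n≤1+n (b * C)) ⟩
    b * β * q + q      ≡⟨ +-comm (b * β * q) q ⟩
    suc (b * β) * q    ≤⟨ *-monoˡ-≤ q lt ⟩
    (a + b) * γ * q    ∎
  expand₁ : ∀ a b x y q → (a * x + b * y) * (q * q) ≡ a * x * (q * q) + b * (y * (q * q))
  expand₁ = solve-∀
  expand₂ : ∀ a b x q β C → a * x * (q * q) + b * (x * (q * q + β * q + C)) ≡
    x * ((a + b) * (q * q) + (b * β * q + b * C))
  expand₂ = solve-∀
  expand₃ : ∀ N u v q γ → u * v * (N * (q * q) + N * γ * q) ≡ N * v * q * (u * (q + γ))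
  expand₃ = solve-∀
  expand₄ : ∀ N v q w → N * v * q * (w * q) ≡ N * (w * v) * (q * q)
  expand₄ = solve-∀

2*q^q≤[1+q]^q : ∀ p → let q = suc p in 2 * q ^ q ≤ suc q ^ q
2*q^q≤[1+q]^q p = *-cancelʳ-≤ _ _ q (begin
  2 * q ^ q * q    ≡⟨ rearrange (q ^ q) q ⟩
  q ^ q * (q + q)  ≤⟨ bernoulli-≤ q q ⟩
  suc q ^ q * q    ∎)
  where
  open ≤-Reasoning
  q = suc p
  rearrange : ∀ x q → 2 * x * q ≡ x * (q + q)
  rearrange = solve-∀

^-distribʳ-* : ∀ m n o → (m * n) ^ o ≡ m ^ o * n ^ o
^-distribʳ-* m n zero    = refl
^-distribʳ-* m n (suc o) rewrite ^-distribʳ-* m n o = rearrange m n (m ^ o) (n ^ o)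
  where
  rearrange : ∀ a b c d → a * b * (c * d) ≡ a * c * (b * d)
  rearrange = solve-∀

growth-≤ : ∀ p h → let q = suc p in 2 ^ h * q ^ (q * h) ≤ suc q ^ (q * h)
growth-≤ p h = begin
  2 ^ h * q ^ (q * h)  ≡⟨ cong (2 ^ h *_) (^-*-assoc q q h) ⟨
  2 ^ h * (q ^ q) ^ h  ≡⟨ ^-distribʳ-* 2 (q ^ q) h ⟨
  (2 * q ^ q) ^ h      ≤⟨ ^-monoˡ-≤ h (2*q^q≤[1+q]^q p) ⟩
  (suc q ^ q) ^ h      ≡⟨ ^-*-assoc (suc q) q h ⟩
  suc q ^ (q * h)      ∎
  where
  open ≤-Reasoning
  q = suc p

-- With z = 1 + 1/q the hypothesis is z^m < U. Every `q` factors of z at least double, so m ≥ q h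
-- would give z^m ≥ 2^h ≥ U.
exponent-≤ : ∀ p {U h m} → let q = suc p in U ≤ 2 ^ h → suc q ^ m < U * q ^ m → m ≤ q * h
exponent-≤ p {U} {h} {m} U≤2^h lt with ≤-total m (suc p * h)
... | inj₁ m≤t = m≤t
... | inj₂ t≤m = contradiction lt (≤⇒≯ (begin
  U * q ^ m                ≤⟨ *-monoˡ-≤ (q ^ m) U≤2^h ⟩
  2 ^ h * q ^ m            ≡⟨ cong (λ m → 2 ^ h * q ^ m) m≡ ⟩
  2 ^ h * q ^ (t + l)      ≡⟨ cong (2 ^ h *_) (^-distribˡ-+-* q t l) ⟩
  2 ^ h * (q ^ t * q ^ l)  ≡⟨ *-assoc (2 ^ h) (q ^ t) (q ^ l) ⟨
  2 ^ h * q ^ t * q ^ l    ≤⟨ *-mono-≤ (growth-≤ p h) (^-monoˡ-≤ l (n≤1+n q)) ⟩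
  suc q ^ t * suc q ^ l    ≡⟨ ^-distribˡ-+-* (suc q) t l ⟨
  suc q ^ (t + l)          ≡⟨ cong (suc q ^_) m≡ ⟨
  suc q ^ m                ∎))
  where
  open ≤-Reasoning
  q = suc p
  t = q * h
  l = m ∸ t
  m≡ : m ≡ t + l
  m≡ = sym (m+[n∸m]≡n t≤m)

-- Division by q^(β(X+Y)) turns the hypothesis into z^(βY) < U z^(γ(X+Y)), and βY - γ(X+Y) = α(X+Y)
-- - βX. The case split keeps this difference from being truncated.
deviation-≤ : ∀ p γ α {U h} X Y → let q = suc p; β = γ + α in U ≤ 2 ^ h →
  (q ^ β) ^ X * (suc q ^ β) ^ Y < U * (suc q ^ γ * q ^ α) ^ (X + Y) →
  α * (X + Y) ≤ β * X + q * h
deviation-≤ p γ α {U} {h} X Y U≤2^h lt with ≤-total (α * (X + Y)) ((γ + α) * X)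
... | inj₁ le = ≤-trans le (m≤m+n _ _)
... | inj₂ ge = subst (_≤ β * X + q * h) (m+[n∸m]≡n ge) (+-monoʳ-≤ (β * X) (exponent-≤ p U≤2^h lt′))
  where
  q = suc p
  β = γ + α
  M = X + Y
  m = α * M ∸ β * X
  αM≡ : α * M ≡ β * X + m
  αM≡ = sym (m+[n∸m]≡n ge)
  βY≡ : β * Y ≡ γ * M + m
  βY≡ = +-cancelˡ-≡ (β * X) _ _ (begin
    β * X + β * Y        ≡⟨ *-distribˡ-+ β X Y ⟨
    (γ + α) * M          ≡⟨ *-distribʳ-+ M γ α ⟩
    γ * M + α * M        ≡⟨ cong (γ * M +_) αM≡ ⟩
    γ * M + (β * X + m)  ≡⟨ rearrange (γ * M) (β * X) m ⟩
    β * X + (γ * M + m)  ∎)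
    where
    open ≡-Reasoning
    rearrange : ∀ a b c → a + (b + c) ≡ b + (a + c)
    rearrange = solve-∀
  c = q ^ (β * X) * suc q ^ (γ * M)
  lhs≡ : (q ^ β) ^ X * (suc q ^ β) ^ Y ≡ c * suc q ^ m
  lhs≡ = begin
    (q ^ β) ^ X * (suc q ^ β) ^ Y                ≡⟨ cong₂ _*_ (^-*-assoc q β X) (^-*-assoc (suc q) β Y) ⟩
    q ^ (β * X) * suc q ^ (β * Y)                ≡⟨ cong (λ e → q ^ (β * X) * suc q ^ e) βY≡ ⟩
    q ^ (β * X) * suc q ^ (γ * M + m)            ≡⟨ cong (q ^ (β * X) *_) (^-distribˡ-+-* (suc q) (γ * M) m) ⟩
    q ^ (β * X) * (suc q ^ (γ * M) * suc q ^ m)  ≡⟨ *-assoc (q ^ (β * X)) _ _ ⟨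
    c * suc q ^ m                                ∎
    where open ≡-Reasoning
  rhs≡ : U * (suc q ^ γ * q ^ α) ^ M ≡ c * (U * q ^ m)
  rhs≡ = begin
    U * (suc q ^ γ * q ^ α) ^ M                    ≡⟨ cong (U *_) (^-distribʳ-* (suc q ^ γ) (q ^ α) M) ⟩
    U * ((suc q ^ γ) ^ M * (q ^ α) ^ M)            ≡⟨ cong (U *_) (cong₂ _*_ (^-*-assoc (suc q) γ M) (^-*-assoc q α M)) ⟩
    U * (suc q ^ (γ * M) * q ^ (α * M))            ≡⟨ cong (λ e → U * (suc q ^ (γ * M) * q ^ e)) αM≡ ⟩
    U * (suc q ^ (γ * M) * q ^ (β * X + m))        ≡⟨ cong (λ e → U * (suc q ^ (γ * M) * e)) (^-distribˡ-+-* q (β * X) m) ⟩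
    U * (suc q ^ (γ * M) * (q ^ (β * X) * q ^ m))  ≡⟨ rearrange U (suc q ^ (γ * M)) (q ^ (β * X)) (q ^ m) ⟩
    c * (U * q ^ m)                                ∎
    where
    open ≡-Reasoning
    rearrange : ∀ U s t v → U * (s * (t * v)) ≡ t * s * (U * v)
    rearrange = solve-∀
  lt′ : suc q ^ m < U * q ^ m
  lt′ = *-cancelˡ-< c _ _ (subst₂ _<_ lhs≡ rhs≡ lt)

1+n≤2^n : ∀ n → suc n ≤ 2 ^ n
1+n≤2^n zero    = ≤-refl
1+n≤2^n (suc n) = begin
  suc (suc n)        ≤⟨ s≤s (s≤s (m≤m+n n n)) ⟩
  suc (suc (n + n))  ≡⟨ rearrange n ⟩
  2 * suc n          ≤⟨ *-monoʳ-≤ 2 (1+n≤2^n n) ⟩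
  2 * 2 ^ n          ∎
  where
  open ≤-Reasoning
  rearrange : ∀ n → suc (suc (n + n)) ≡ 2 * suc n
  rearrange = solve-∀

-- Puts the number of events, graphs times classes plus one, below a power of two. The crude bound
-- on `c` adds only the number of classes, which is linear in n, to the exponent.
1+2^e*c≤2^[e+c] : ∀ e c → suc (2 ^ e * c) ≤ 2 ^ (e + c)
1+2^e*c≤2^[e+c] e c = begin
  1 + 2 ^ e * c      ≤⟨ +-monoˡ-≤ (2 ^ e * c) (m^n>0 2 e) ⟩
  2 ^ e + 2 ^ e * c  ≡⟨ *-suc (2 ^ e) c ⟨
  2 ^ e * suc c      ≤⟨ *-monoʳ-≤ (2 ^ e) (1+n≤2^n c) ⟩
  2 ^ e * 2 ^ c      ≡⟨ ^-distribˡ-+-* 2 e c ⟨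
  2 ^ (e + c)        ∎
  where open ≤-Reasoning

-- For `j` at least 1 the linear number of classes is also O(n^j), so the error is O(n^(1+j)). The
-- missing factor n pays for all constants and for the denominator `s` of μ.
total-error-≤ : ∀ j k q s n → 1 ≤ j → suc k * q * (2 + k) * s ≤ n → 1 ≤ n →
  suc (k * n) * (q * (n ^ j + suc (k * n))) * s ≤ n ^ (2 + j)
total-error-≤ j@(suc j′) k q s n 1≤j big 1≤n = begin
  suc (k * n) * (q * (n ^ j + suc (k * n))) * s      ≤⟨ *-monoˡ-≤ s (*-mono-≤ (+-monoˡ-≤ (k * n) 1≤n) (*-monoʳ-≤ q
                                                         (+-monoʳ-≤ (n ^ j) (+-mono-≤ 1≤x (*-monoʳ-≤ k n≤x))))) ⟩
  suc k * n * (q * (x + (x + k * x))) * s  ≡⟨ rearrange₁ k n q x s ⟩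
  suc k * q * (2 + k) * s * (n * x)        ≤⟨ *-monoˡ-≤ (n * x) big ⟩
  n * (n * x)                              ∎
  where
  open ≤-Reasoning
  x = n ^ j
  1≤x : 1 ≤ x
  1≤x = m^n>0 n {{>-nonZero 1≤n}} j
  n≤x : n ≤ x
  n≤x = m≤m*n n (n ^ j′) {{m^n≢0 n j′ {{>-nonZero 1≤n}}}}
  rearrange₁ : ∀ k n q x s → suc k * n * (q * (x + (x + k * x))) * s ≡ suc k * q * (2 + k) * s * (n * x)
  rearrange₁ = solve-∀

-- A good colouring

∧-true : ∀ a {b} → a ∧ b ≡ true → a ≡ true × b ≡ true
∧-true true {true} _ = refl , refl

≡ᵇ-true : ∀ {m n} → (m ≡ᵇ n) ≡ true → m ≡ n
≡ᵇ-true {m} {n} eq = ≡ᵇ⇒≡ m n (Equivalence.from T-≡ eq)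

isClique⇒size : ∀ {n} j k (G : Graph n) e → isClique j k G e ≡ true → ∣ e ∣ ≡ k
isClique⇒size j k G e eq = ≡ᵇ-true (proj₁ (∧-true (ofSize k e) eq))

list-deviation-≤ : ∀ p γ α U h (m ed : A → Bool) xs → let q = suc p; β = γ + α; D = suc q ^ γ * q ^ α in
  U ≤ 2 ^ h →
  ∏ xs (λ x → if m x then (if ed x then q ^ β else suc q ^ β) else D) < U * D ^ length xs →
  α * count m xs ≤ β * count (λ x → m x ∧ ed x) xs + q * h
list-deviation-≤ p γ α U h m ed xs U≤2^h small = subst (λ M → α * M ≤ β * X + q * h) (count-∧-split m ed xs)
  -- Non-members contribute `D ^ Z` to both sides; cancelling it leaves a bound on the class alone.
  (deviation-≤ p γ α {U} {h} X Y U≤2^h (*-cancelʳ-< (D ^ Z) _ _ (begin-strict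
    (q ^ β) ^ X * (suc q ^ β) ^ Y * D ^ Z   ≡⟨ ∏-if-if m ed (q ^ β) (suc q ^ β) D xs ⟨
    ∏ xs (λ x → if m x then (if ed x then q ^ β else suc q ^ β) else D)
                                            <⟨ small ⟩
    U * D ^ length xs          ≡⟨ cong (λ l → U * D ^ l) length≡ ⟨
    U * D ^ (X + Y + Z)        ≡⟨ cong (U *_) (^-distribˡ-+-* D (X + Y) Z) ⟩
    U * (D ^ (X + Y) * D ^ Z)  ≡⟨ *-assoc U (D ^ (X + Y)) (D ^ Z) ⟨
    U * D ^ (X + Y) * D ^ Z    ∎)))
  where
  open ≤-Reasoning
  q = suc p
  β = γ + α
  D = suc q ^ γ * q ^ α
  X = count (λ x → m x ∧ ed x) xs
  Y = count (λ x → m x ∧ not (ed x)) xs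
  Z = count (not ∘ m) xs
  length≡ : X + Y + Z ≡ length xs
  length≡ = trans (cong (_+ Z) (count-∧-split m ed xs)) (count+count-not m xs)

∧-swap : ∀ x y z → (x ∧ y) ∧ z ≡ (x ∧ z) ∧ y
∧-swap true  y z = ∧-comm y z
∧-swap false y z = refl

partition-deviation-≤ : ∀ α β t (m ed : A → Bool) (key : A → ℕ) N xs → (∀ x → m x ≡ true → key x < N) →
  (∀ {c} → c < N → α * count (λ x → m x ∧ (key x ≡ᵇ c)) xs ≤
    β * count (λ x → (m x ∧ (key x ≡ᵇ c)) ∧ ed x) xs + t) →
  α * count m xs ≤ β * count (λ x → m x ∧ ed x) xs + N * t
partition-deviation-≤ α β t m ed key N xs bounded classwise = begin
  α * count m xs                                     ≡⟨ cong (α *_) (count-partition m key N xs bounded) ⟩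
  α * ∑ (upTo N) M                                   ≡⟨ *-distribˡ-∑ (upTo N) α M ⟨
  ∑ (upTo N) (λ c → α * M c)                         ≤⟨ ∑-mono-local (upTo N) (λ c∈ → classwise (∈-upTo⁻ c∈)) ⟩
  ∑ (upTo N) (λ c → β * X c + t)                     ≡⟨ ∑-distrib-+ (upTo N) (λ c → β * X c) (λ _ → t) ⟩
  ∑ (upTo N) (λ c → β * X c) + ∑ (upTo N) (λ _ → t)  ≡⟨ cong₂ _+_ (*-distribˡ-∑ (upTo N) β X) (trans (∑-const (upTo N) t) (cong (_* t) (length-upTo N))) ⟩
  β * ∑ (upTo N) X + N * t                           ≡⟨ cong (λ x → β * x + N * t) (∑-cong (upTo N) λ c → count-cong xs λ x → ∧-swap (m x) (key x ≡ᵇ c) (ed x)) ⟩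
  β * ∑ (upTo N) (λ c → count (λ x → (m x ∧ ed x) ∧ (key x ≡ᵇ c)) xs) + N * t
                                                       ≡⟨ cong (λ x → β * x + N * t) (count-partition (λ x → m x ∧ ed x) key N xs
                                                            (λ x mx → bounded x (proj₁ (∧-true (m x) mx)))) ⟨
  β * count (λ x → m x ∧ ed x) xs + N * t              ∎
  where
  open ≤-Reasoning
  M X : ℕ → ℕ
  M c = count (λ x → m x ∧ (key x ≡ᵇ c)) xs
  X c = count (λ x → (m x ∧ (key x ≡ᵇ c)) ∧ ed x) xs

module RandomColouring (r n j k : ℕ) .{{_ : NonZero r}} (P : List (Fin r) → Bool) (a b D : ℕ) .{{_ : NonZero D}}
  (mean≤ : count P (allTuples r k) * a + count (not ∘ P) (allTuples r k) * b ≤ r ^ k * D) where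

  open Colourings (_≟ˢ_ {n}) r
  open DecMembership (_≟ˢ_ {n}) using (_∈?_)

  inClass : Graph n → ℕ → Subset n → Bool
  inClass G c e = isClique j k G e ∧ (vertexSum e ≡ᵇ c)

  edge : Colouring → Subset n → Bool
  edge ψ e = P (map ψ (boundary e))

  -- The weight D of non-members gives all classes, whatever their size, the same bound D^Q on the mean.
  weight : Bool → Subset n → Colouring → ℕ
  weight m e ψ = if m then (if edge ψ e then a else b) else D

  weight-ext : ∀ m e → Extensional (weight m e)
  weight-ext true  e = tuple-ext (boundary e) (λ t → if P t then a else b)
  weight-ext false e = λ _ → refl

  weight-independent : ∀ {s} m e → s ∉ boundary e → Independent s (weight m e)
  weight-independent true  e s∉∂e = tuple-independent (boundary e) (λ t → if P t then a else b) s∉∂e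
  weight-independent false e s∉∂e = λ _ _ → refl

  -- The boundary of a `k`-set consists of `k` distinct sets, so its colours are a uniform `k`-tuple
  -- and `mean≤` applies.
  weight-mean : ∀ m e → (m ≡ true → ∣ e ∣ ≡ k) → ∀ ψ →
    sumOver (allSubsets n) (weight m e) ψ ≤ r ^ length (allSubsets n) * D
  weight-mean false e _     ψ = ≤-reflexive (sumOver-const (allSubsets n) D ψ)
  weight-mean true  e size  ψ = *-cancelˡ-≤ (r ^ k) {{m^n≢0 r k}} (begin
    r ^ k * sumOver L (weight true e) ψ              ≡⟨ cong (λ l → r ^ l * sumOver L (weight true e) ψ) len ⟨
    r ^ length (boundary e) * sumOver L (weight true e) ψ
                                                ≡⟨ sumOver-tuple-mean L (boundary e) (boundary-unique e) (λ _ → ∈-allSubsets _) (λ t → if P t then a else b) ψ ⟩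
    R * ∑ (allTuples r (length (boundary e))) (λ t → if P t then a else b)
                                                ≡⟨ cong (λ l → R * ∑ (allTuples r l) (λ t → if P t then a else b)) len ⟩
    R * ∑ (allTuples r k) (λ t → if P t then a else b)
                                                ≡⟨ cong (R *_) (∑-if P a b (allTuples r k)) ⟩
    R * (count P (allTuples r k) * a + count (not ∘ P) (allTuples r k) * b)
                                                ≤⟨ *-monoʳ-≤ R mean≤ ⟩
    R * (r ^ k * D)  ≡⟨ rearrange R (r ^ k) D ⟩
    r ^ k * (R * D)  ∎)
    where
    open ≤-Reasoning
    L = allSubsets n
    R = r ^ length L
    len : length (boundary e) ≡ k
    len = trans (length-boundary e) (size refl)
    rearrange : ∀ x y z → x * (y * z) ≡ y * (x * z)
    rearrange = solve-∀

  -- A set in both boundaries would identify two members of one class by `boundary-disjoint`; the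
  -- weight of a non-member is constant.
  weights-disjoint : ∀ G c {e e′} → e ≢ e′ → ∀ s →
    Independent s (weight (inClass G c e) e) ⊎ Independent s (weight (inClass G c e′) e′)
  weights-disjoint G c {e} {e′} e≢e′ s with inClass G c e in m | inClass G c e′ in m′
  ... | false | _     = inj₁ λ _ _ → refl
  ... | true  | false = inj₂ λ _ _ → refl
  ... | true  | true  with s ∈? boundary e
  ...   | no  s∉∂e = inj₁ (weight-independent true e s∉∂e)
  ...   | yes s∈∂e = inj₂ (weight-independent true e′ λ s∈∂e′ → e≢e′ (boundary-disjoint
    (trans (sum≡ e m) (sym (sum≡ e′ m′))) s∈∂e s∈∂e′))
    where
    sum≡ : ∀ e → inClass G c e ≡ true → vertexSum e ≡ c
    sum≡ e m = ≡ᵇ-true (proj₂ (∧-true (isClique j k G e) m))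

  classWeight : Graph n → ℕ → Colouring → ℕ
  classWeight G c ψ = ∏ (allSubsets n) λ e → weight (inClass G c e) e ψ

  -- Both the coordinates of a colouring and the factors of `classWeight` are indexed by all
  -- subsets, so one exponent serves `r` and `D`.
  Q : ℕ
  Q = length (allSubsets n)

  classWeight-mean : ∀ G c ψ → sumOver (allSubsets n) (classWeight G c) ψ ≤ r ^ Q * D ^ Q
  classWeight-mean G c = sumOver-∏-≤ (allSubsets n)
    (λ e → weight-ext (inClass G c e) e)
    (λ e → weight-mean (inClass G c e) e λ m → isClique⇒size j k G e (proj₁ (∧-true (isClique j k G e) m)))
    (AllPairs.map (weights-disjoint G c) (allSubsets-unique n))

  Gs : List (Graph n)
  Gs = graphsOn (subsetsOfSize n j)

  -- The union bound as a single sum: all terms are nonnegative, so a small total bounds every graph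
  -- and class at once.
  potential : ℕ → Colouring → ℕ
  potential N ψ = ∑ Gs λ G → ∑ (upTo N) λ c → classWeight G c ψ

  potential-mean : ∀ N ψ → sumOver (allSubsets n) (potential N) ψ < r ^ Q * (suc (2 ^ (n ^ j) * N) * D ^ Q)
  potential-mean N ψ = begin-strict
    sumOver L (potential N) ψ                                     ≡⟨ sumOver-∑ L Gs (λ G ψ′ → ∑ (upTo N) λ c → classWeight G c ψ′) ψ ⟩
    ∑ Gs (λ G → sumOver L (λ ψ′ → ∑ (upTo N) λ c → classWeight G c ψ′) ψ)
                                                             ≡⟨ ∑-cong Gs (λ G → sumOver-∑ L (upTo N) (classWeight G) ψ) ⟩
    ∑ Gs (λ G → ∑ (upTo N) λ c → sumOver L (classWeight G c) ψ)  ≤⟨ ∑-mono-≤ Gs (λ G → ∑-mono-≤ (upTo N) λ c → classWeight-mean G c ψ) ⟩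
    ∑ Gs (λ G → ∑ (upTo N) λ c → M)                              ≡⟨ ∑-cong Gs (λ G → trans (∑-const (upTo N) M) (cong (_* M) (length-upTo N))) ⟩
    ∑ Gs (λ G → N * M)                                           ≡⟨ ∑-const Gs (N * M) ⟩
    length Gs * (N * M)                                          ≡⟨ cong (_* (N * M)) (length-graphsOn (subsetsOfSize n j)) ⟩
    2 ^ length (subsetsOfSize n j) * (N * M)                     ≤⟨ *-monoˡ-≤ (N * M) (^-monoʳ-≤ 2 (length-subsetsOfSize-≤ n j)) ⟩
    2 ^ (n ^ j) * (N * M)                                        ≡⟨ rearrange (2 ^ (n ^ j)) N (r ^ Q) (D ^ Q) ⟩
    -- One extra unit beyond the number of events makes the inequality strict, as the averaging
    -- argument requires.
    r ^ Q * (2 ^ (n ^ j) * N * D ^ Q)                            <⟨ *-monoʳ-< (r ^ Q) {{m^n≢0 r Q}} (*-monoˡ-< (D ^ Q) {{m^n≢0 D Q}} (n<1+n (2 ^ (n ^ j) * N))) ⟩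
    r ^ Q * (suc (2 ^ (n ^ j) * N) * D ^ Q)                      ∎
    where
    open ≤-Reasoning
    L = allSubsets n
    M = r ^ Q * D ^ Q
    rearrange : ∀ x y z w → x * (y * (z * w)) ≡ z * (x * y * w)
    rearrange = solve-∀

  exists-good : ∀ N → Colouring → ∃ λ ψ → ∀ {G c} → G ∈ Gs → c < N →
    classWeight G c ψ < suc (2 ^ (n ^ j) * N) * D ^ Q
  exists-good N ψ₀ with sumOver-<⇒∃ (allSubsets n) (potential N) (suc (2 ^ (n ^ j) * N) * D ^ Q) ψ₀ (potential-mean N ψ₀)
  ... | ψ , small = ψ , λ {G} {c} G∈Gs c<N → ≤-<-trans
    (≤-trans (≤∑ (λ c → classWeight G c ψ) (∈-upTo⁺ c<N)) (≤∑ (λ G → ∑ (upTo N) λ c → classWeight G c ψ) G∈Gs)) small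

isClique∧isEdge : ∀ {r n} j k (P : List (Fin r) → Bool) (ψ : Subset n → Fin r) (G : Graph n) e →
  isClique j k G e ∧ isEdgeᵇ k (Hψ k P ψ) e ≡ isClique j k G e ∧ P (map ψ (boundary e))
isClique∧isEdge j k P ψ G e with ofSize k e
... | true  = cong (λ t → _ ∧ P t) (map-∘ (elements e))
... | false = refl

colouring-deviation-≤ : ∀ {r} n j k (P : List (Fin r) → Bool) p γ α (ψ : Subset n → Fin r) →
  let q = suc p; β = γ + α; D = suc q ^ γ * q ^ α; N = suc (k * n) in
  (∀ {G c} → G ∈ graphsOn (subsetsOfSize n j) → c < N →
    ∏ (allSubsets n) (λ e → if isClique j k G e ∧ (vertexSum e ≡ᵇ c)
      then (if P (map ψ (boundary e)) then q ^ β else suc q ^ β) else D)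
    < suc (2 ^ (n ^ j) * N) * D ^ length (allSubsets n)) →
  ∀ G → α * length (Kk j k G) ≤ β * count (isEdgeᵇ k (Hψ k P ψ)) (Kk j k G) + N * (q * (n ^ j + N))
colouring-deviation-≤ n j k P p γ α ψ small = deviation
  where
  open ≤-Reasoning
  q = suc p
  β = γ + α
  N = suc (k * n)
  t = q * (n ^ j + N)
  xs = allSubsets n
  edge : Subset n → Bool
  edge e = P (map ψ (boundary e))
  vertexSum<N : ∀ (G : Graph n) e → isClique j k G e ≡ true → vertexSum e < N
  vertexSum<N G e m = s≤s (subst (λ s → vertexSum e ≤ s * n) (isClique⇒size j k G e m) (vertexSum-≤ e))
  deviation-enumerated : ∀ {G} → G ∈ graphsOn (subsetsOfSize n j) →
    α * count (isClique j k G) xs ≤ β * count (λ e → isClique j k G e ∧ edge e) xs + N * t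
  deviation-enumerated {G} G∈ = partition-deviation-≤ α β t (isClique j k G) edge vertexSum N xs (vertexSum<N G) λ {c} c<N →
    list-deviation-≤ p γ α (suc (2 ^ (n ^ j) * N)) (n ^ j + N) (λ e → isClique j k G e ∧ (vertexSum e ≡ᵇ c)) edge xs
      (1+2^e*c≤2^[e+c] (n ^ j) N) (small G∈ c<N)
  deviation : ∀ G → α * length (Kk j k G) ≤ β * count (isEdgeᵇ k (Hψ k P ψ)) (Kk j k G) + N * t
  -- Both counts see `G` only through its cliques, so a listed graph with the same `j`-edges stands
  -- in for it.
  deviation G with graphsOn-complete G (subsetsOfSize n j)
  ... | G′ , G′∈ , agree = begin
    α * count (isClique j k G) xs                            ≡⟨ cong (α *_) (count-cong xs K≗) ⟩
    α * count (isClique j k G′) xs                           ≤⟨ deviation-enumerated G′∈ ⟩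
    β * count (λ e → isClique j k G′ e ∧ edge e) xs + N * t  ≡⟨ cong (λ x → β * x + N * t) (count-cong xs λ e → trans
                                                                      (cong (_∧ edge e) (sym (K≗ e))) (sym (isClique∧isEdge j k P ψ G e))) ⟩
    β * count (λ e → isClique j k G e ∧ isEdgeᵇ k (Hψ k P ψ) e) xs + N * t
                                                                 ≡⟨ cong (λ x → β * x + N * t) (count-filter (isEdgeᵇ k (Hψ k P ψ)) (isClique j k G) xs) ⟨
    β * count (isEdgeᵇ k (Hψ k P ψ)) (Kk j k G) + N * t          ∎
    where
    K≗ : ∀ e → isClique j k G e ≡ isClique j k G′ e
    K≗ = isClique-cong j k (sym ∘ agree)

exists-dense-colouring : ∀ r n j k .{{_ : NonZero r}} (P : List (Fin r) → Bool) p γ α → let q = suc p; N = suc (k * n) in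
  count P (allTuples r k) * q ^ (γ + α) + count (not ∘ P) (allTuples r k) * suc q ^ (γ + α)
    ≤ r ^ k * (suc q ^ γ * q ^ α) →
  (Subset n → Fin r) →
  ∃ λ (ψ : Subset n → Fin r) → ∀ G → α * length (Kk j k G) ≤
    (γ + α) * count (isEdgeᵇ k (Hψ k P ψ)) (Kk j k G) + N * (q * (n ^ j + N))
exists-dense-colouring r n j k P p γ α mean≤ ψ₀ =
  map₂ (λ {ψ} → colouring-deviation-≤ n j k P p γ α ψ)
    (RandomColouring.exists-good r n j k P (q ^ (γ + α)) (suc q ^ (γ + α)) (suc q ^ γ * q ^ α)
      {{m*n≢0 (suc q ^ γ) (q ^ α) {{m^n≢0 (suc q) γ}} {{m^n≢0 q α}}}} mean≤ (suc (k * n)) ψ₀)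
  where q = suc p

-- Passage to ℚ

open import Data.Integer using (+_; -[1+_])

toℚᵘ-ℕ→ℚ : ∀ m → toℚᵘ (ℕ→ℚ m) ℚᵘ.≃ mkℚᵘ (+ m) 0
toℚᵘ-ℕ→ℚ m = ℚ.toℚᵘ-fromℚᵘ (mkℚᵘ (+ m) 0)

toℚᵘ-*-ℕ→ℚ : ∀ d m → toℚᵘ (d ℚ.* ℕ→ℚ m) ℚᵘ.≃ toℚᵘ d ℚᵘ.* mkℚᵘ (+ m) 0
toℚᵘ-*-ℕ→ℚ d m = ℚᵘ.≃-trans (ℚ.toℚᵘ-homo-* d (ℕ→ℚ m)) (ℚᵘ.*-congˡ {toℚᵘ d} (toℚᵘ-ℕ→ℚ m))

scaled-<⇒ : ∀ α β-1 .(c : Coprime α (suc β-1)) N a → mkℚ (+ α) β-1 c ℚ.* ℕ→ℚ N ℚ.< ℕ→ℚ a → α * N < a * suc β-1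
scaled-<⇒ α β-1 c N a lt
  with ℚᵘ.<-respˡ-≃ (toℚᵘ-*-ℕ→ℚ (mkℚ (+ α) β-1 c) N) (ℚᵘ.<-respʳ-≃ (toℚᵘ-ℕ→ℚ a) (ℚ.toℚᵘ-mono-< lt))
... | *<* lt′ = ℤ.drop‿+<+ (subst₂ ℤ._<_ lhs rhs lt′)
  where
  lhs : + α ℤ.* + N ℤ.* + 1 ≡ + (α * N)
  lhs = trans (ℤ.*-identityʳ _) (sym (ℤ.pos-* α N))
  rhs : + a ℤ.* + (suc β-1 * 1) ≡ + (a * suc β-1)
  rhs = trans (sym (ℤ.pos-* a _)) (cong (λ b → + (a * b)) (*-identityʳ (suc β-1)))

p≤q+r⇒p-r≤q : ∀ {p q r} → p ℚ.≤ q ℚ.+ r → p ℚ.- r ℚ.≤ q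
p≤q+r⇒p-r≤q {p} {q} {r} le = subst (p ℚ.- r ℚ.≤_)
  (trans (ℚ.+-assoc q r (ℚ.- r)) (trans (cong (q ℚ.+_) (ℚ.+-inverseʳ r)) (ℚ.+-identityʳ q)))
  (ℚ.+-monoˡ-≤ (ℚ.- r) le)

density-≤ : ∀ α β-1 .(c : Coprime α (suc β-1)) u s-1 .(c′ : Coprime u (suc s-1)) K W X →
  α * K * suc s-1 ≤ (X * suc s-1 + u * W) * suc β-1 →
  mkℚ (+ α) β-1 c ℚ.* ℕ→ℚ K ℚ.- mkℚ (+ u) s-1 c′ ℚ.* ℕ→ℚ W ℚ.≤ ℕ→ℚ X
density-≤ α β-1 c u s-1 c′ K W X le = p≤q+r⇒p-r≤q (ℚ.toℚᵘ-cancel-≤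
  (ℚᵘ.≤-respˡ-≃ (ℚᵘ.≃-sym (toℚᵘ-*-ℕ→ℚ d K))
  (ℚᵘ.≤-respʳ-≃ (ℚᵘ.≃-sym (ℚᵘ.≃-trans (ℚ.toℚᵘ-homo-+ (ℕ→ℚ X) (μ ℚ.* ℕ→ℚ W))
                                       (ℚᵘ.+-cong (toℚᵘ-ℕ→ℚ X) (toℚᵘ-*-ℕ→ℚ μ W))))
    (*≤* (subst₂ ℤ._≤_ (sym lhs) (sym rhs) (ℤ.+≤+ le))))))
  where
  d = mkℚ (+ α) β-1 c
  μ = mkℚ (+ u) s-1 c′
  s = suc s-1
  β = suc β-1
  lhs : + α ℤ.* + K ℤ.* + (1 * (s * 1)) ≡ + (α * K * s)
  lhs = trans (cong₂ ℤ._*_ (sym (ℤ.pos-* α K)) (cong +_ (trans (*-identityˡ (s * 1)) (*-identityʳ s)))) (sym (ℤ.pos-* (α * K) s))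
  rhs : (+ X ℤ.* + (s * 1) ℤ.+ + u ℤ.* + W ℤ.* + 1) ℤ.* + (β * 1) ≡ + ((X * s + u * W) * β)
  rhs = trans (cong₂ ℤ._*_ (cong₂ ℤ._+_
      (trans (cong (λ t → + X ℤ.* + t) (*-identityʳ s)) (sym (ℤ.pos-* X s)))
      (trans (ℤ.*-identityʳ _) (sym (ℤ.pos-* u W))))
      (cong +_ (*-identityʳ β)))
    (trans (cong (ℤ._* + β) (sym (ℤ.pos-+ (X * s) (u * W)))) (sym (ℤ.pos-* (X * s + u * W) β)))

-- With γ/β = 1 - α/β, the assumption that α/β is below the proportion of good tuples says that the
-- proportion of bad tuples is below γ/β.
complement-gap : ∀ a b α β → α * (a + b) < a * β → ∃ λ γ → γ + α ≡ β × b * (γ + α) < (a + b) * γ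
complement-gap a b α β lt = β ∸ α , γ+α≡β , +-cancelʳ-< ((a + b) * α) _ _ (begin-strict
  b * (γ + α) + (a + b) * α  ≡⟨ cong₂ _+_ (cong (b *_) γ+α≡β) (*-comm (a + b) α) ⟩
  b * β + α * (a + b)        <⟨ +-monoʳ-< (b * β) lt ⟩
  b * β + a * β              ≡⟨ +-comm (b * β) (a * β) ⟩
  a * β + b * β              ≡⟨ *-distribʳ-+ β a b ⟨
  (a + b) * β                ≡⟨ cong ((a + b) *_) γ+α≡β ⟨
  (a + b) * (γ + α)          ≡⟨ *-distribˡ-+ (a + b) γ α ⟩
  (a + b) * γ + (a + b) * α  ∎)
  where
  open ≤-Reasoning
  γ = β ∸ α
  α<β : α < β
  α<β = *-cancelʳ-< (a + b) _ _ (begin-strict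
    α * (a + b)  <⟨ lt ⟩
    a * β        ≤⟨ *-monoˡ-≤ β (m≤m+n a b) ⟩
    (a + b) * β  ≡⟨ *-comm (a + b) β ⟩
    β * (a + b)  ∎)
  γ+α≡β : γ + α ≡ β
  γ+α≡β = m∸n+n≡m (<⇒≤ α<β)

-- After division by the denominator of d the error is at most `E`, hence at most W/s, and μ =
-- (u+1)/s is at least 1/s.
absorb-error : ∀ {α β K X E s W} u → α * K ≤ suc β * X + E → E * s ≤ W → α * K * s ≤ (X * s + suc u * W) * suc β
absorb-error {α} {β} {K} {X} {E} {s} {W} u main err = begin
  α * K * s                          ≤⟨ *-monoˡ-≤ s main ⟩
  (suc β * X + E) * s                ≡⟨ *-distribʳ-+ s (suc β * X) E ⟩
  suc β * X * s + E * s              ≤⟨ +-monoʳ-≤ (suc β * X * s) (≤-trans err (≤-trans (m≤m+n W (u * W)) (m≤m*n (suc u * W) (suc β)))) ⟩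
  suc β * X * s + suc u * W * suc β  ≡⟨ rearrange β X s (suc u * W) ⟩
  (X * s + suc u * W) * suc β        ∎
  where
  open ≤-Reasoning
  rearrange : ∀ β X s V → suc β * X * s + V * suc β ≡ (X * s + V) * suc β
  rearrange = solve-∀

dense-colouring : ∀ {r} .{{_ : NonZero r}} j k → 1 ≤ j → k ≡ 2 + j → (P : List (Fin r) → Bool) →
  ∀ α β-1 .(c : Coprime α (suc β-1)) u s-1 .(c′ : Coprime (suc u) (suc s-1)) p γ n → let q = suc p in
  γ + α ≡ suc β-1 →
  count P (allTuples r k) * q ^ (γ + α) + count (not ∘ P) (allTuples r k) * suc q ^ (γ + α)
    ≤ r ^ k * (suc q ^ γ * q ^ α) →
  suc k * q * (2 + k) * suc s-1 ≤ n → 1 ≤ n → (Subset n → Fin r) →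
  ∃ λ ψ → Dense {n} k j (mkℚ (+ α) β-1 c) (mkℚ (+ suc u) s-1 c′) (Hψ k P ψ)
dense-colouring {r} j k 1≤j k≡2+j P α β-1 c u s-1 c′ p γ n γ+α≡β mean≤ big 1≤n ψ₀ =
  map₂ (λ {ψ} → dense {ψ}) (exists-dense-colouring r n j k P p γ α mean≤ ψ₀)
  where
  q = suc p
  E = suc (k * n) * (q * (n ^ j + suc (k * n)))
  error≤ : E * suc s-1 ≤ n ^ k
  error≤ = subst (λ l → E * suc s-1 ≤ n ^ l) (sym k≡2+j) (total-error-≤ j k q (suc s-1) n 1≤j big 1≤n)
  dense : ∀ {ψ : Subset n → Fin r} → (∀ G → α * length (Kk j k G) ≤
    (γ + α) * count (isEdgeᵇ k (Hψ k P ψ)) (Kk j k G) + E) →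
    Dense k j (mkℚ (+ α) β-1 c) (mkℚ (+ suc u) s-1 c′) (Hψ k P ψ)
  dense {ψ} deviation G = density-≤ α β-1 c (suc u) s-1 c′ K (n ^ k) X (absorb-error {α} {β-1} {K} {X} {E} u
    (subst (λ β → α * K ≤ β * X + E) γ+α≡β (deviation G)) error≤)
    where
    K = length (Kk j k G)
    X = count (isEdgeᵇ k (Hψ k P ψ)) (Kk j k G)

inPiSet-below : ∀ {m r} .{{_ : NonZero r}} j k → 1 ≤ j → k ≡ 2 + j → (F : Graph m) (P : List (Fin r) → Bool) → Fin r →
  ((n : ℕ) → (ψ : Subset n → Fin r) → Free k F (Hψ k P ψ)) →
  ∀ α β-1 .(c : Coprime α (suc β-1)) → α * r ^ k < count P (allTuples r k) * suc β-1 →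
  ∀ u s-1 .(c′ : Coprime (suc u) (suc s-1)) n₀ →
  ∃ λ n → n₀ ≤ n × ∃ λ H → Free k F H × Dense {n} k j (mkℚ (+ α) β-1 c) (mkℚ (+ suc u) s-1 c′) H
inPiSet-below {r = r} j k 1≤j k≡2+j F P x₀ free α β-1 c lt u s-1 c′ n₀ =
  let a = count P (allTuples r k)
      b = count (not ∘ P) (allTuples r k)
      a+b≡r^k : a + b ≡ r ^ k
      a+b≡r^k = trans (count+count-not P (allTuples r k)) (length-allTuples r k)
      γ , γ+α≡β , gap = complement-gap a b α (suc β-1) (subst (λ N → α * N < a * suc β-1) (sym a+b≡r^k) lt)
      p , mean≤ = mean-weight-≤ a b γ α gap
      -- `p` comes from d and `P` alone, so this threshold does not depend on `n`.
      big = suc k * suc p * (2 + k) * suc s-1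
      n = n₀ + suc big
      ψ , dense = dense-colouring j k 1≤j k≡2+j P α β-1 c u s-1 c′ p γ n γ+α≡β
        (subst (λ N → a * suc p ^ (γ + α) + b * suc (suc p) ^ (γ + α) ≤ N * (suc (suc p) ^ γ * suc p ^ α)) a+b≡r^k mean≤)
        (≤-trans (n≤1+n big) (m≤n+m (suc big) n₀)) (≤-trans (s≤s z≤n) (m≤n+m (suc big) n₀)) (λ _ → x₀)
  in n , m≤m+n n₀ (suc big) , Hψ k P ψ , free n ψ , dense

theorem1p10 : (k : ℕ) → 3 ≤ k → (m : ℕ) → (F : Graph m) →
    (r : ℕ) → (P : List (Fin r) → Bool) →
    ((n : ℕ) → (ψ : Subset n → Fin r) → Free k F (Hψ k P ψ)) →
    PiAtLeast k (k ∸ 2) F (count P (allTuples r k)) (r ^ k)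
theorem1p10 k 3≤k m F r P free (mkℚ -[1+ _ ] _ _) (ℚ.*≤* ()) lt
theorem1p10 k 3≤k m F r P free (mkℚ (+ α) β-1 c) 0≤d lt (mkℚ (+ 0) _ _) (ℚ.*<* (ℤ.+<+ ()))
theorem1p10 k 3≤k m F r P free (mkℚ (+ α) β-1 c) 0≤d lt (mkℚ -[1+ _ ] _ _) (ℚ.*<* ())
-- Without colours there are no tuples of positive length and `r ^ k` is 0, so `lt` reads d * 0 < 0.
-- Matching on `suc k` lets both quantities reduce to 0.
theorem1p10 (suc k) 3≤k m F zero P free (mkℚ (+ α) β-1 c) 0≤d lt (mkℚ (+ suc u) s-1 c′) 0<μ n₀ =
  contradiction (scaled-<⇒ α β-1 c 0 0 lt) λ ()
theorem1p10 k 3≤k m F (suc r) P free (mkℚ (+ α) β-1 c) 0≤d lt (mkℚ (+ suc u) s-1 c′) 0<μ n₀ =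
  inPiSet-below (k ∸ 2) k (∸-monoˡ-≤ 2 3≤k) (sym (m+[n∸m]≡n (<⇒≤ 3≤k))) F P zero free
    α β-1 c (scaled-<⇒ α β-1 c (suc r ^ k) (count P (allTuples (suc r) k)) lt) u s-1 c′ n₀
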